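{- Let $(K,\mathcal{L})$ be a $C$-minimal valued field and let $f\colon X\subseteq K\to K^\times$ be a definable function defined at a neighborhood of infinity. Then $f$ factorizes at infinity over $\Gamma$ through a definable function $h$; that is, there are a definable function $h\colon \Gamma_K\to\Gamma_K$ and $\gamma_0\in\Gamma_K$ such that $v(f(x))=h(v(x))$ for all $x\in X\setminus B(0,\gamma_0)$.
   Context: Valued fields $(K,v)$ are non-trivially valued; $\Gamma_K$ is the value group. Closed balls are $B(a,\gamma)=\{x\in K: v(x-a)\geq\gamma\}$ for $a \in K$, $\gamma\in\Gamma_K\cup\{+\infty\}$; open balls are $B^\circ(a,\gamma)=\{x\in K: v(x-a)>\gamma\}$ for $a\in K$, $\gamma\in\Gamma_K\cup\{ -\infty\}$ (so points are closed balls and $K$ is an open ball). A ball is a closed or an open ball. $\mathcal{L}_{div}=(+,-,\cdot,0,1,\mathrm{div})$ is the language of valued fields, with $\mathrm{div}(x,y)$ interpreted as $v(x)\leq v(y)$. Let $K$ be an algebraically closed valued field and $(K,\mathcal{L})$ an expansion of $(K,\mathcal{L}_{div})$ ($\mathcal{L}\supseteq\mathcal{L}_{div}$). $(K,\mathcal{L})$ is $C$-minimal (a "$C$-minimal valued field") if for every structure $(K',\mathcal{L})$ elementarily equivalent to it, every $\mathcal{L}$-definable subset of $K'$ is a boolean combination of balls. "Definable" means $\mathcal{L}$-definable with parameters; for subsets of (products involving) $\Gamma_K$ it means interpretable. A neighborhood of infinity is a set of the form $K\setminus B(0,\gamma)$ with $\gamma\in\Gamma_K$; $f\colon X\subseteq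 K\to K$ is defined at a neighborhood of infinity if $X$ contains such a set. -}

module Defs where

open import Algebra.Structures using (IsAbelianGroup; IsCommutativeRing)
open import Data.Fin.Base using (Fin)
open import Data.Nat.Base using (ℕ; suc; _+_)
open import Data.Product.Base using (Σ; ∃; _×_; _,_; proj₁; proj₂)
open import Data.Sum.Base using (_⊎_; inj₁; inj₂)
open import Data.Vec.Base using (Vec; []; _∷_; _++_; head; last; lookup)
open import Data.Vec.Relation.Binary.Pointwise.Inductive using (Pointwise)
open import Function.Bundles using (Func; _⇔_)
open import Level using (Level; _⊔_) renaming (suc to lsuc)
open import Relation.Binary.Bundles using (Setoid)
open import Relation.Binary.Core using (Rel)
open import Relation.Binary.Structures using (IsEquivalence; IsTotalOrder)
open import Relation.Nullary.Construct.Add.Infimum using (_₋; ⊥₋)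
open import Relation.Nullary.Construct.Add.Supremum using (_⁺; ⊤⁺; [_])
open import Relation.Nullary.Negation.Core using (¬_)
open import Relation.Unary using (Pred; ∁; _∩_; _∪_; _≐_; _∈_; _∉_)
open import Relation.Unary.Polymorphic using (U)
import Relation.Binary.Construct.Add.Supremum.Equality as AddSupEq
import Relation.Binary.Construct.Add.Supremum.NonStrict as AddSup
import Relation.Binary.Construct.Add.Supremum.Strict as AddSupStrict
import Relation.Binary.Construct.NonStrictToStrict as ToStrict
import Relation.Binary.Construct.On as On

private
  variable
    ℓ : Level

------------------------------------------------------------------------
-- First-order logic

record Language (ℓ : Level) : Set (lsuc ℓ) where
  field
    FunSym : ℕ → Set ℓ
    RelSym : ℕ → Set ℓ

open Language

_⊕_ : Language ℓ → Language ℓ → Language ℓ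
(L ⊕ L′) .FunSym n = L .FunSym n ⊎ L′ .FunSym n
(L ⊕ L′) .RelSym n = L .RelSym n ⊎ L′ .RelSym n

-- Equality of a structure is a setoid equality, so that quotients (such as
-- ultrapowers) are structures; all symbols respect it.
record Structure (L : Language ℓ) : Set (lsuc ℓ) where
  infix 4 _≈_
  field
    Carrier       : Set ℓ
    _≈_           : Rel Carrier ℓ
    isEquivalence : IsEquivalence _≈_
    fun           : ∀ {n} → L .FunSym n → Vec Carrier n → Carrier
    fun-cong      : ∀ {n} (f : L .FunSym n) {xs ys} →
                    Pointwise _≈_ xs ys → fun f xs ≈ fun f ys
    rel           : ∀ {n} → L .RelSym n → Pred (Vec Carrier n) ℓ
    rel-resp      : ∀ {n} (r : L .RelSym n) {xs ys} →
                    Pointwise _≈_ xs ys → rel r xs → rel r ys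

  setoid : Setoid ℓ ℓ
  setoid = record { isEquivalence = isEquivalence }

module _ (L : Language ℓ) where

  data Term (n : ℕ) : Set ℓ where
    var : Fin n → Term n
    app : ∀ {k} → L .FunSym k → Vec (Term n) k → Term n

  -- The remaining connectives are classically definable from these.
  data Formula (n : ℕ) : Set ℓ where
    equal  : Term n → Term n → Formula n
    atom   : ∀ {k} → L .RelSym k → Vec (Term n) k → Formula n
    not    : Formula n → Formula n
    conj   : Formula n → Formula n → Formula n
    exists : Formula (suc n) → Formula n

module _ {L : Language ℓ} (M : Structure L) where
  private module M = Structure M

  mutual
    eval : ∀ {n} → Vec M.Carrier n → Term L n → M.Carrier
    eval ρ (var i)    = lookup ρ i
    eval ρ (app f ts) = M.fun f (evals ρ ts)

    evals : ∀ {n k} → Vec M.Carrier n → Vec (Term L n) k → Vec M.Carrier k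
    evals ρ []       = []
    evals ρ (t ∷ ts) = eval ρ t ∷ evals ρ ts

  -- In `exists`, the bound variable is the variable with index zero.
  Sat : ∀ {n} → Formula L n → Pred (Vec M.Carrier n) ℓ
  Sat (equal s t) ρ = eval ρ s M.≈ eval ρ t
  Sat (atom r ts) ρ = M.rel r (evals ρ ts)
  Sat (not φ)     ρ = ¬ Sat φ ρ
  Sat (conj φ ψ)  ρ = Sat φ ρ × Sat ψ ρ
  Sat (exists φ)  ρ = ∃ λ a → Sat φ (a ∷ ρ)

  Definable : ∀ {n} → Pred (Vec M.Carrier n) ℓ → Set ℓ
  Definable {n} S =
    ∃ λ m → Σ (Formula L (n + m)) λ φ → Σ (Vec M.Carrier m) λ ps →
      ∀ xs → xs ∈ S ⇔ Sat φ (xs ++ ps)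

  Definable₁ : Pred M.Carrier ℓ → Set ℓ
  Definable₁ S = Definable {1} λ xs → head xs ∈ S

ElementarilyEquivalent : {L : Language ℓ} → Structure L → Structure L → Set ℓ
ElementarilyEquivalent {L = L} M N =
  (σ : Formula L 0) → Sat M σ [] ⇔ Sat N σ []

data BooleanCombination {A : Set ℓ} {b} (B : Pred (Pred A ℓ) b) :
                        Pred (Pred A ℓ) (lsuc ℓ ⊔ b) where
  gen  : ∀ {S} → B S → BooleanCombination B S
  comp : ∀ {S} → BooleanCombination B S → BooleanCombination B (∁ S)
  cap  : ∀ {S T} → BooleanCombination B S → BooleanCombination B T →
         BooleanCombination B (S ∩ T)
  cup  : ∀ {S T} → BooleanCombination B S → BooleanCombination B T →
         BooleanCombination B (S ∪ T)
  ext  : ∀ {S T} → S ≐ T → BooleanCombination B S → BooleanCombination B T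

------------------------------------------------------------------------
-- The language of valued fields

data DivFun {ℓ} : ℕ → Set ℓ where
  zero# one# : DivFun 0
  neg#       : DivFun 1
  add# mul#  : DivFun 2

data DivRel {ℓ} : ℕ → Set ℓ where
  div# : DivRel 2

𝓛div : Language ℓ
𝓛div .FunSym = DivFun
𝓛div .RelSym = DivRel

-- `𝓛div ⊕ L` for varying L ranges over the languages containing 𝓛div.
module DivSymbols {L : Language ℓ} (M : Structure (𝓛div ⊕ L)) where
  open Structure M public

  infixl 6 _+ᴷ_ _-ᴷ_
  infixl 7 _*ᴷ_

  0ᴷ 1ᴷ : Carrier
  0ᴷ = fun (inj₁ zero#) []
  1ᴷ = fun (inj₁ one#) []

  -ᴷ_ : Carrier → Carrier
  -ᴷ x = fun (inj₁ neg#) (x ∷ [])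

  _+ᴷ_ _-ᴷ_ _*ᴷ_ : Carrier → Carrier → Carrier
  x +ᴷ y = fun (inj₁ add#) (x ∷ y ∷ [])
  x *ᴷ y = fun (inj₁ mul#) (x ∷ y ∷ [])
  x -ᴷ y = x +ᴷ (-ᴷ y)

  Div : Rel Carrier ℓ
  Div x y = rel (inj₁ div#) (x ∷ y ∷ [])

  -- The polynomial with the given coefficients, constant term first.
  evalPoly : ∀ {n} → Vec Carrier n → Carrier → Carrier
  evalPoly []       x = 0ᴷ
  evalPoly (c ∷ cs) x = c +ᴷ x *ᴷ evalPoly cs x

  AlgebraicallyClosed : Set ℓ
  AlgebraicallyClosed = ∀ {d} (cs : Vec Carrier (suc (suc d))) →
    ¬ last cs ≈ 0ᴷ → ∃ λ x → evalPoly cs x ≈ 0ᴷ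

------------------------------------------------------------------------
-- Valued fields

record OrderedAbelianGroup (ℓ : Level) : Set (lsuc ℓ) where
  infix  4 _≈_ _≤_
  infixl 6 _∙_
  field
    Carrier        : Set ℓ
    _≈_            : Rel Carrier ℓ
    _≤_            : Rel Carrier ℓ
    _∙_            : Carrier → Carrier → Carrier
    ε              : Carrier
    _⁻¹            : Carrier → Carrier
    isAbelianGroup : IsAbelianGroup _≈_ _∙_ ε _⁻¹
    isTotalOrder   : IsTotalOrder _≈_ _≤_
    ∙-monoˡ-≤      : ∀ z {x y} → x ≤ y → x ∙ z ≤ y ∙ z

  setoid : Setoid ℓ ℓ
  setoid = record { isEquivalence = IsTotalOrder.isEquivalence isTotalOrder }

  open AddSupEq _≈_ public using (_≈⁺_)
  open AddSup _≤_ public using (_≤⁺_)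
  open AddSupStrict (ToStrict._<_ _≈_ _≤_) public using (_<⁺_)

  -- γ + ∞ = ∞ + γ = ∞ + ∞ = ∞
  _∙⁺_ : Carrier ⁺ → Carrier ⁺ → Carrier ⁺
  [ γ ] ∙⁺ [ δ ] = [ γ ∙ δ ]
  [ γ ] ∙⁺ ⊤⁺    = ⊤⁺
  ⊤⁺    ∙⁺ δ     = ⊤⁺

-- The structure M is an expansion of (K, 𝓛div) for a non-trivially valued
-- field (K, v) with value group Γ.
record ValuedField {L : Language ℓ} (M : Structure (𝓛div ⊕ L)) : Set (lsuc ℓ) where
  open DivSymbols M public
  field
    isCommutativeRing : IsCommutativeRing _≈_ _+ᴷ_ _*ᴷ_ -ᴷ_ 0ᴷ 1ᴷ
    0≉1               : ¬ 0ᴷ ≈ 1ᴷ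
    inverse           : ∀ x → ¬ x ≈ 0ᴷ → ∃ λ y → x *ᴷ y ≈ 1ᴷ
    valueGroup        : OrderedAbelianGroup ℓ

  module Γ = OrderedAbelianGroup valueGroup
  open Γ public using (_≈⁺_; _≤⁺_; _<⁺_; _∙⁺_)

  field
    v            : Carrier → Γ.Carrier ⁺
    v-cong       : ∀ {x y} → x ≈ y → v x ≈⁺ v y
    v≈∞⇔≈0       : ∀ x → (v x ≈⁺ ⊤⁺) ⇔ (x ≈ 0ᴷ)
    v-*          : ∀ x y → v (x *ᴷ y) ≈⁺ (v x ∙⁺ v y)
    v-+          : ∀ x y → (v x ≤⁺ v (x +ᴷ y)) ⊎ (v y ≤⁺ v (x +ᴷ y))
    v-surjective : ∀ γ → ∃ λ x → v x ≈⁺ [ γ ]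
    nontrivial   : ∃ λ γ → ¬ γ Γ.≈ Γ.ε
    div⇔≤        : ∀ x y → Div x y ⇔ (v x ≤⁺ v y)

  closedBall : Carrier → Γ.Carrier ⁺ → Pred Carrier ℓ
  closedBall a γ x = γ ≤⁺ v (x -ᴷ a)

  openBall : Carrier → Γ.Carrier ₋ → Pred Carrier ℓ
  openBall a ⊥₋    x = U x
  openBall a [ γ ] x = [ γ ] <⁺ v (x -ᴷ a)

  data IsBall : Pred (Pred Carrier ℓ) (lsuc ℓ) where
    closed : ∀ a γ → IsBall (closedBall a γ)
    open′  : ∀ a γ → IsBall (openBall a γ)

  ContainsNeighborhoodOfInfinity : Pred Carrier ℓ → Set ℓ
  ContainsNeighborhoodOfInfinity X =
    ∃ λ γ → ∀ x → x ∉ closedBall 0ᴷ [ γ ] → x ∈ X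

  unitsSetoid : Setoid ℓ ℓ
  unitsSetoid = On.setoid {B = Σ Carrier λ x → ¬ x ≈ 0ᴷ} setoid proj₁

  subsetSetoid : Pred Carrier ℓ → Setoid ℓ ℓ
  subsetSetoid X = On.setoid {B = Σ Carrier X} setoid proj₁

  DefinableFunction : (X : Pred Carrier ℓ) → Func (subsetSetoid X) unitsSetoid → Set ℓ
  DefinableFunction X f =
    Definable M {2} λ { (x ∷ y ∷ []) → Σ (x ∈ X) λ x∈X → proj₁ (Func.to f (x , x∈X)) ≈ y }

  -- A subset of Γⁿ is interpretable when its preimage under v in (K^×)ⁿ is
  -- definable, Γ being the definable quotient of K^× by v(x) = v(y).
  InterpretableΓ : ∀ {n} → Pred (Vec Γ.Carrier n) ℓ → Set ℓ
  InterpretableΓ {n} T =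
    Definable M {n} λ xs → ∃ λ γs → Pointwise (λ x γ → v x ≈⁺ [ γ ]) xs γs × γs ∈ T

  DefinableΓFunction : Func Γ.setoid Γ.setoid → Set ℓ
  DefinableΓFunction h =
    InterpretableΓ {2} λ { (γ ∷ δ ∷ []) → Func.to h γ Γ.≈ δ }

-- A structure elementarily equivalent to N satisfies the axioms of valued
-- fields, which are first order in 𝓛div; `V′` is the resulting valuation
-- (unique up to isomorphism of the value group, by `div⇔≤`).
record CMinimal {L : Language ℓ} (N : Structure (𝓛div ⊕ L)) (V : ValuedField N) :
                Set (lsuc ℓ) where
  field
    algebraicallyClosed : ValuedField.AlgebraicallyClosed V
    definable⇒balls     :
      (N′ : Structure (𝓛div ⊕ L)) → ElementarilyEquivalent N N′ →
      (V′ : ValuedField N′) → (S : Pred (Structure.Carrier N′) ℓ) →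
      Definable₁ N′ S → BooleanCombination (ValuedField.IsBall V′) S

-- A set that is a boolean combination of balls is decided by certain filters:
-- by every filter of unions of spheres that concentrates at a cut of the value
-- group (such as the cut at infinity), and by the filter of sets containing all
-- but finitely many residue classes of a given sphere {x : v(x) = v(c)}.
-- By the second kind of filter, v(f) is generically constant on each sphere:
-- otherwise the residue classes a of the sphere would have infinitely many
-- endpoints inf v(f(a)), of which only finitely many lie below a given value,
-- and the definable set of these endpoints would be infinite and discrete near
-- a cut of the dense value group, against the first kind of filter. The same
-- argument applied to 1/f bounds v(f) from the other side.
-- Finally "v(f(x)) is the generic value of v(f) on the sphere of x" is a
-- first-order property of x, which holds somewhere on every sphere, hence on a
-- neighbourhood of infinity.

module Submission where

open import Defs
import Algebra.Properties.CommutativeSemigroup as CommutativeSemigroupProperties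
import Algebra.Properties.Group as GroupProperties
import Algebra.Properties.Ring as RingProperties
open import Algebra.Bundles using (CommutativeMonoid; CommutativeRing; Group)
open import Algebra.Structures using (IsAbelianGroup)
open import Axiom.ExcludedMiddle using (ExcludedMiddle)
open import Data.Empty using (⊥; ⊥-elim)
open import Data.Fin.Base as Fin using (Fin; zero; suc; _↑ˡ_; join; splitAt)
open import Data.Fin.Patterns using (0F; 1F; 2F; 3F)
open import Data.List.Base as List using (List; []; _∷_)
open import Data.List.Properties using (length-map)
open import Data.List.Relation.Unary.All as All using (All; []; _∷_)
import Data.List.Relation.Unary.All.Properties as AllProperties
open import Data.List.Relation.Unary.Any using (Any)
import Data.List.Relation.Unary.Any.Properties as AnyProperties
open import Data.Nat.Base using (ℕ; zero; suc; _+_)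
open import Data.Product.Base as Product using (Σ; ∃; ∃₂; _×_; _,_; proj₁; proj₂; swap)
open import Data.Sum.Base as Sum using (_⊎_; inj₁; inj₂; [_,_]′)
open import Data.Vec.Base as Vec using (Vec; []; _∷_)
open import Data.Vec.Properties using (lookup-++ˡ; lookup-++ʳ; lookup-splitAt)
open import Data.Vec.Relation.Binary.Pointwise.Inductive using ([]; _∷_)
open import Function.Base using (_∘_)
open import Function.Bundles using (Func; _⇔_; mk⇔; Equivalence)
open import Function.Properties.Equivalence using () renaming (refl to ⇔-refl; sym to ⇔-sym; trans to ⇔-trans)
open import Level using (Level) renaming (suc to lsuc)
import Relation.Binary.Construct.Add.Supremum.Equality as AddSupEq
import Relation.Binary.Construct.Add.Supremum.NonStrict as AddSup
import Relation.Binary.Construct.Add.Supremum.Strict as AddSupStrict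
open import Relation.Binary.PropositionalEquality as ≡ using (_≡_)
open import Relation.Binary.Structures using (IsTotalOrder)
open import Relation.Nullary.Construct.Add.Infimum as Inf using (⊥₋)
open import Relation.Nullary.Construct.Add.Supremum using (⊤⁺; [_])
open import Relation.Nullary.Decidable.Core using (yes; no; decidable-stable)
open import Relation.Nullary.Negation.Core using (¬_; contradiction)
open import Relation.Unary using (Pred; _∉_; ∁; _⊆_; _∩_; _≐_)

open Equivalence using (to; from)

module Valuation {ℓ : Level} (em : ExcludedMiddle ℓ) {L : Language ℓ}
                 (K : Structure (𝓛div ⊕ L)) (V : ValuedField K) where
  open ValuedField V public

  commutativeRing : CommutativeRing ℓ ℓ
  commutativeRing = record { isCommutativeRing = isCommutativeRing }

  open CommutativeRing commutativeRing public
    using (refl; reflexive; sym; trans; +-cong; +-congˡ; +-congʳ; *-cong; *-congˡ; *-congʳ;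
           -‿cong; *-identityˡ; *-identityʳ; *-comm; *-assoc; zeroʳ; zeroˡ; distribˡ; distribʳ;
           -‿inverseʳ; +-assoc; +-comm; +-identityˡ; +-identityʳ)
  open RingProperties (CommutativeRing.ring commutativeRing) public
    using (-‿distribˡ-*; -‿distribʳ-*; -‿+-comm; -‿involutive; -0#≈0#)
    renaming (⁻¹-anti-homo‿- to -[x-y]≈y-x; //-rightDividesˡ to [x-y]+y≈x)

  open CommutativeSemigroupProperties (CommutativeRing.*-commutativeSemigroup commutativeRing) public
    using (x∙yz≈y∙xz)
  open CommutativeSemigroupProperties
    (CommutativeMonoid.commutativeSemigroup (CommutativeRing.+-commutativeMonoid commutativeRing)) public
    using (xy∙z≈xz∙y; interchange)

  private
    module ΓO = IsTotalOrder Γ.isTotalOrder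

    Γ-group : Group ℓ ℓ
    Γ-group = record { isGroup = IsAbelianGroup.isGroup Γ.isAbelianGroup }

  dne : {P : Set ℓ} → ¬ ¬ P → P
  dne = decidable-stable em

  -- Order of values and ultrametric arithmetic.

  ≈⁺-refl : ∀ {α} → α ≈⁺ α
  ≈⁺-refl = AddSupEq.≈⁺-refl Γ._≈_ ΓO.Eq.refl

  ≈⁺-sym : ∀ {α β} → α ≈⁺ β → β ≈⁺ α
  ≈⁺-sym = AddSupEq.≈⁺-sym Γ._≈_ ΓO.Eq.sym

  ≈⁺-trans : ∀ {α β γ} → α ≈⁺ β → β ≈⁺ γ → α ≈⁺ γ
  ≈⁺-trans = AddSupEq.≈⁺-trans Γ._≈_ ΓO.Eq.trans

  ≤⁺-trans : ∀ {α β γ} → α ≤⁺ β → β ≤⁺ γ → α ≤⁺ γ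
  ≤⁺-trans = AddSup.≤⁺-trans Γ._≤_ ΓO.trans

  ≤⁺-reflexive : ∀ {α β} → α ≈⁺ β → α ≤⁺ β
  ≤⁺-reflexive = AddSup.≤⁺-reflexive Γ._≤_ ΓO.reflexive

  ∙⁺-monoˡ-≤⁺ : ∀ {α β} γ → α ≤⁺ β → (α ∙⁺ γ) ≤⁺ (β ∙⁺ γ)
  ∙⁺-monoˡ-≤⁺ [ γ ] AddSup.[ p ]    = AddSup.[ Γ.∙-monoˡ-≤ γ p ]
  ∙⁺-monoˡ-≤⁺ ⊤⁺    AddSup.[ p ]    = ⊤⁺ AddSup.≤⊤⁺
  ∙⁺-monoˡ-≤⁺ γ     (α AddSup.≤⊤⁺)  = _ AddSup.≤⊤⁺

  <⁺⇒≰⁺ : ∀ {γ β} → [ γ ] <⁺ β → ¬ (β ≤⁺ [ γ ])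
  <⁺⇒≰⁺ AddSupStrict.[ p , q ] AddSup.[ r ] = q (ΓO.antisym p r)

  ≰⁺⇒<⁺ : ∀ {γ β} → ¬ (β ≤⁺ [ γ ]) → [ γ ] <⁺ β
  ≰⁺⇒<⁺ {β = ⊤⁺}        β≰γ = AddSupStrict.[ _ ]<⊤⁺
  ≰⁺⇒<⁺ {γ} {β = [ β ]} β≰γ with ΓO.total γ β
  ... | inj₁ p = AddSupStrict.[ p , (λ γ≈β → β≰γ AddSup.[ ΓO.reflexive (ΓO.Eq.sym γ≈β) ]) ]
  ... | inj₂ q = contradiction AddSup.[ q ] β≰γ

  infix 4 _≼_ _≺_ _∼_

  -- Values are compared through field elements: by `div⇔≤` the relation `≼` is an atomic formula,
  -- so statements phrased with these relations are first order. The value +∞ is represented by 0.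
  _≼_ _≺_ _∼_ : Carrier → Carrier → Set ℓ
  x ≼ y = v x ≤⁺ v y
  x ≺ y = ¬ (y ≼ x)
  x ∼ y = x ≼ y × y ≼ x

  ≼-trans : ∀ {x y z} → x ≼ y → y ≼ z → x ≼ z
  ≼-trans = ≤⁺-trans

  ≼-reflexive : ∀ {x y} → x ≈ y → x ≼ y
  ≼-reflexive = ≤⁺-reflexive ∘ v-cong

  ≼-refl : ∀ {x} → x ≼ x
  ≼-refl = ≼-reflexive refl

  ≼-total : ∀ x y → x ≼ y ⊎ y ≼ x
  ≼-total x y = AddSup.≤⁺-total Γ._≤_ ΓO.total (v x) (v y)

  ≺⇒≼ : ∀ {x y} → x ≺ y → x ≼ y
  ≺⇒≼ {x} {y} x≺y with ≼-total x y
  ... | inj₁ p = p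
  ... | inj₂ q = contradiction q x≺y

  ≺-≼-trans : ∀ {x y z} → x ≺ y → y ≼ z → x ≺ z
  ≺-≼-trans x≺y y≼z z≼x = x≺y (≼-trans y≼z z≼x)

  ≼-≺-trans : ∀ {x y z} → x ≼ y → y ≺ z → x ≺ z
  ≼-≺-trans x≼y y≺z z≼x = y≺z (≼-trans z≼x x≼y)

  ≺-trans : ∀ {x y z} → x ≺ y → y ≺ z → x ≺ z
  ≺-trans x≺y y≺z = ≺-≼-trans x≺y (≺⇒≼ y≺z)

  ∼-refl : ∀ {x} → x ∼ x
  ∼-refl = ≼-refl , ≼-refl

  ∼-reflexive : ∀ {x y} → x ≈ y → x ∼ y
  ∼-reflexive x≈y = ≼-reflexive x≈y , ≼-reflexive (sym x≈y)

  ∼-sym : ∀ {x y} → x ∼ y → y ∼ x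
  ∼-sym = swap

  ∼-trans : ∀ {x y z} → x ∼ y → y ∼ z → x ∼ z
  ∼-trans (p , p′) (q , q′) = ≼-trans p q , ≼-trans q′ p′

  v0≈∞ : v 0ᴷ ≈⁺ ⊤⁺
  v0≈∞ = Equivalence.from (v≈∞⇔≈0 0ᴷ) refl

  ≼0 : ∀ x → x ≼ 0ᴷ
  ≼0 x = ≤⁺-trans (v x AddSup.≤⊤⁺) (≤⁺-reflexive (≈⁺-sym v0≈∞))

  0≼⇒≈0 : ∀ {x} → 0ᴷ ≼ x → x ≈ 0ᴷ
  0≼⇒≈0 {x} 0≼x = Equivalence.to (v≈∞⇔≈0 x)
    (AddSup.≤⁺-antisym Γ._≤_ ΓO.antisym (v x AddSup.≤⊤⁺)
      (≤⁺-trans (≤⁺-reflexive (≈⁺-sym v0≈∞)) 0≼x))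

  ≉0⇒≺0 : ∀ {x} → ¬ x ≈ 0ᴷ → x ≺ 0ᴷ
  ≉0⇒≺0 x≉0 0≼x = x≉0 (0≼⇒≈0 0≼x)

  ≺⇒≉0 : ∀ {x y} → x ≺ y → ¬ x ≈ 0ᴷ
  ≺⇒≉0 {x} {y} x≺y x≈0 = x≺y (≼-trans (≼0 y) (≼-reflexive (sym x≈0)))

  ∼-resp-≉0 : ∀ {x y} → x ∼ y → ¬ x ≈ 0ᴷ → ¬ y ≈ 0ᴷ
  ∼-resp-≉0 (x≼y , y≼x) x≉0 y≈0 = x≉0 (0≼⇒≈0 (≼-trans (≼-reflexive (sym y≈0)) y≼x))

  +-mono-≼ : ∀ {x y z} → z ≼ x → z ≼ y → z ≼ x +ᴷ y
  +-mono-≼ {x} {y} z≼x z≼y with v-+ x y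
  ... | inj₁ x≼x+y = ≼-trans z≼x x≼x+y
  ... | inj₂ y≼x+y = ≼-trans z≼y y≼x+y

  +-mono-≺ : ∀ {x y z} → z ≺ x → z ≺ y → z ≺ x +ᴷ y
  +-mono-≺ {x} {y} z≺x z≺y with v-+ x y
  ... | inj₁ x≼x+y = ≺-≼-trans z≺x x≼x+y
  ... | inj₂ y≼x+y = ≺-≼-trans z≺y y≼x+y

  *-monoˡ-≼ : ∀ {x y} z → x ≼ y → x *ᴷ z ≼ y *ᴷ z
  *-monoˡ-≼ {x} {y} z x≼y =
    ≤⁺-trans (≤⁺-reflexive (v-* x z))
      (≤⁺-trans (∙⁺-monoˡ-≤⁺ (v z) x≼y) (≤⁺-reflexive (≈⁺-sym (v-* y z))))

  *-mono-≼ : ∀ {x y z w} → x ≼ y → z ≼ w → x *ᴷ z ≼ y *ᴷ w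
  *-mono-≼ {x} {y} {z} {w} x≼y z≼w =
    ≼-trans (*-monoˡ-≼ z x≼y) (≼-trans (≼-reflexive (*-comm y z))
      (≼-trans (*-monoˡ-≼ y z≼w) (≼-reflexive (*-comm w y))))

  *-cancelʳ-≼ : ∀ {x y} z → ¬ z ≈ 0ᴷ → x *ᴷ z ≼ y *ᴷ z → x ≼ y
  *-cancelʳ-≼ {x} {y} z z≉0 xz≼yz with inverse z z≉0
  ... | z⁻¹ , zz⁻¹≈1 =
    ≼-trans (≼-reflexive (sym (cancel x))) (≼-trans (*-monoˡ-≼ z⁻¹ xz≼yz) (≼-reflexive (cancel y)))
    where
    cancel : ∀ t → t *ᴷ z *ᴷ z⁻¹ ≈ t
    cancel t = trans (*-assoc t z z⁻¹) (trans (*-congˡ zz⁻¹≈1) (*-identityʳ t))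

  *-cancelˡ-≼ : ∀ {x y} z → ¬ z ≈ 0ᴷ → z *ᴷ x ≼ z *ᴷ y → x ≼ y
  *-cancelˡ-≼ {x} {y} z z≉0 zx≼zy = *-cancelʳ-≼ z z≉0
    (≼-trans (≼-reflexive (*-comm x z)) (≼-trans zx≼zy (≼-reflexive (*-comm z y))))

  *-monoˡ-≺ : ∀ {x y} z → ¬ z ≈ 0ᴷ → x ≺ y → x *ᴷ z ≺ y *ᴷ z
  *-monoˡ-≺ z z≉0 x≺y = x≺y ∘ *-cancelʳ-≼ z z≉0

  *-≉0 : ∀ {x y} → ¬ x ≈ 0ᴷ → ¬ y ≈ 0ᴷ → ¬ x *ᴷ y ≈ 0ᴷ
  *-≉0 {x} {y} x≉0 y≉0 xy≈0 =
    x≉0 (0≼⇒≈0 (*-cancelʳ-≼ y y≉0 (≼-reflexive (trans (zeroˡ y) (sym xy≈0)))))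

  *-inverse-≉0 : ∀ {x y} → x *ᴷ y ≈ 1ᴷ → ¬ y ≈ 0ᴷ
  *-inverse-≉0 {x} xy≈1 y≈0 = 0≉1 (trans (sym (zeroʳ x)) (trans (*-congˡ (sym y≈0)) xy≈1))

  -1*-1≈1 : -ᴷ 1ᴷ *ᴷ -ᴷ 1ᴷ ≈ 1ᴷ
  -1*-1≈1 = trans (sym (-‿distribʳ-* (-ᴷ 1ᴷ) 1ᴷ)) (trans (-‿cong (*-identityʳ (-ᴷ 1ᴷ))) (-‿involutive 1ᴷ))

  -- Since (-1)(-1) = 1, multiplying either inequality between v(-1) and v(1) by -1 yields the
  -- opposite one.
  -1∼1 : -ᴷ 1ᴷ ∼ 1ᴷ
  -1∼1 with ≼-total (-ᴷ 1ᴷ) 1ᴷ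
  ... | inj₁ p = p , ≼-trans (≼-reflexive (sym -1*-1≈1))
                       (≼-trans (*-monoˡ-≼ (-ᴷ 1ᴷ) p) (≼-reflexive (*-identityˡ _)))
  ... | inj₂ q = ≼-trans (≼-reflexive (sym (*-identityˡ _)))
                   (≼-trans (*-monoˡ-≼ (-ᴷ 1ᴷ) q) (≼-reflexive -1*-1≈1)) , q

  -x∼x : ∀ x → -ᴷ x ∼ x
  -x∼x x = ∼-trans (∼-reflexive -x≈x*-1)
    (∼-trans (*-mono-≼ ≼-refl (proj₁ -1∼1) , *-mono-≼ ≼-refl (proj₂ -1∼1)) (∼-reflexive (*-identityʳ x)))
    where
    -x≈x*-1 : -ᴷ x ≈ x *ᴷ -ᴷ 1ᴷ
    -x≈x*-1 = trans (-‿cong (sym (*-identityʳ x))) (-‿distribʳ-* x 1ᴷ)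

  -‿mono-≼ : ∀ {x y z} → z ≼ x → z ≼ y → z ≼ x -ᴷ y
  -‿mono-≼ {y = y} z≼x z≼y = +-mono-≼ z≼x (≼-trans z≼y (proj₂ (-x∼x y)))

  x-y∼y-x : ∀ x y → x -ᴷ y ∼ y -ᴷ x
  x-y∼y-x x y = ∼-trans (∼-sym (-x∼x (x -ᴷ y))) (∼-reflexive (-[x-y]≈y-x x y))

  x-y≈[x-z]+[z-y] : ∀ x y z → x -ᴷ y ≈ (x -ᴷ z) +ᴷ (z -ᴷ y)
  x-y≈[x-z]+[z-y] x y z =
    sym (trans (sym (+-assoc (x -ᴷ z) z (-ᴷ y))) (+-congʳ ([x-y]+y≈x z x)))

  ultrametric-≼ : ∀ {x y z d} → d ≼ x -ᴷ z → d ≼ z -ᴷ y → d ≼ x -ᴷ y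
  ultrametric-≼ {x} {y} {z} p q =
    ≼-trans (+-mono-≼ p q) (≼-reflexive (sym (x-y≈[x-z]+[z-y] x y z)))

  ultrametric-≺ : ∀ {x y z d} → d ≺ x -ᴷ z → d ≺ z -ᴷ y → d ≺ x -ᴷ y
  ultrametric-≺ {x} {y} {z} p q =
    ≺-≼-trans (+-mono-≺ p q) (≼-reflexive (sym (x-y≈[x-z]+[z-y] x y z)))

  -- If v(x - y) exceeded v(x), both summands of x = (x - y) + y would have value above v(x).
  ≺⇒x-y∼x : ∀ {x y} → x ≺ y → x -ᴷ y ∼ x
  ≺⇒x-y∼x {x} {y} x≺y =
    dne (λ x-y⋠x → +-mono-≺ x-y⋠x x≺y (≼-reflexive ([x-y]+y≈x y x))) , -‿mono-≼ ≼-refl (≺⇒≼ x≺y)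

  ≺⇒x-y∼y : ∀ {x y} → y ≺ x → x -ᴷ y ∼ y
  ≺⇒x-y∼y {x} {y} y≺x = ∼-trans (x-y∼y-x x y) (≺⇒x-y∼x y≺x)

  -- In y = x - (x - y) the second term has value above v(c), so y stays on the sphere of c: residue
  -- classes do not leave their sphere.
  ≺[x-y]⇒x∼y : ∀ {x y c} → x ∼ c → c ≺ x -ᴷ y → y ∼ c
  ≺[x-y]⇒x∼y {x} {y} {c} (x≼c , c≼x) c≺x-y =
    dne (λ y⋠c → ≺-≼-trans (+-mono-≺ c≺x-y y⋠c) (≼-reflexive ([x-y]+y≈x y x)) x≼c) ,
    ≼-trans (+-mono-≼ (≼-trans (≺⇒≼ c≺x-y) (proj₂ (-x∼x (x -ᴷ y)))) c≼x) (≼-reflexive -[x-y]+x≈y)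
    where
    -[x-y]+x≈y : -ᴷ (x -ᴷ y) +ᴷ x ≈ y
    -[x-y]+x≈y = trans (+-congʳ (-[x-y]≈y-x x y)) ([x-y]+y≈x x y)

  -- Polynomials with prescribed roots.

  product : List Carrier → Carrier
  product = List.foldr _*ᴷ_ 1ᴷ

  linearFactors : Carrier → List Carrier → List Carrier
  linearFactors x = List.map (λ a → x -ᴷ a)

  -- The coefficients of p + (X - a) * cs.
  mulLinear : ∀ {n} → Carrier → Carrier → Vec Carrier n → Vec Carrier (suc n)
  mulLinear a p []       = p ∷ []
  mulLinear a p (c ∷ cs) = (p -ᴷ a *ᴷ c) ∷ mulLinear a c cs

  evalPoly-mulLinear : ∀ {n} a p (cs : Vec Carrier n) x →
                       evalPoly (mulLinear a p cs) x ≈ p +ᴷ (x -ᴷ a) *ᴷ evalPoly cs x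
  evalPoly-mulLinear a p []       x = +-congˡ (trans (zeroʳ x) (sym (zeroʳ (x -ᴷ a))))
  evalPoly-mulLinear a p (c ∷ cs) x =
    trans (+-cong (+-congˡ (-‿distribˡ-* a c)) (*-congˡ (evalPoly-mulLinear a c cs x)))
      (identity (-ᴷ a) p c x (evalPoly cs x))
    where
    identity : ∀ b p c x e → (p +ᴷ b *ᴷ c) +ᴷ x *ᴷ (c +ᴷ (x +ᴷ b) *ᴷ e) ≈
                             p +ᴷ (x +ᴷ b) *ᴷ (c +ᴷ x *ᴷ e)
    identity b p c x e = trans (+-assoc p (b *ᴷ c) _) (+-congˡ (sym
      (trans (distribˡ (x +ᴷ b) c (x *ᴷ e))
        (trans (+-cong (trans (distribʳ c x b) (+-comm (x *ᴷ c) (b *ᴷ c)))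
                       (x∙yz≈y∙xz (x +ᴷ b) x e))
          (trans (+-assoc (b *ᴷ c) (x *ᴷ c) _) (+-congˡ (sym (distribˡ x c ((x +ᴷ b) *ᴷ e)))))))))

  last-mulLinear : ∀ {n} a p c (cs : Vec Carrier n) →
                   Vec.last (mulLinear a p (c ∷ cs)) ≡ Vec.last (c ∷ cs)
  last-mulLinear a p c []        = ≡.refl
  last-mulLinear a p c (c′ ∷ cs) = last-mulLinear a c c′ cs

  monic : ∀ (as : List Carrier) → Vec Carrier (suc (List.length as))
  monic []       = 1ᴷ ∷ []
  monic (a ∷ as) = mulLinear a 0ᴷ (monic as)

  last-mulLinear-monic : ∀ a p as → Vec.last (mulLinear a p (monic as)) ≡ 1ᴷ
  last-mulLinear-monic a p []        = ≡.refl
  last-mulLinear-monic a p (a′ ∷ as) with monic as | last-mulLinear-monic a′ 0ᴷ as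
  ... | c ∷ cs | eq = ≡.trans (last-mulLinear a p _ (mulLinear a′ c cs)) eq

  evalPoly-monic : ∀ as x → evalPoly (monic as) x ≈ product (linearFactors x as)
  evalPoly-monic []       x = trans (+-congˡ (zeroʳ x)) (+-identityʳ 1ᴷ)
  evalPoly-monic (a ∷ as) x =
    trans (evalPoly-mulLinear a 0ᴷ (monic as) x)
      (trans (+-identityˡ _) (*-congˡ (evalPoly-monic as x)))

  -- Passage between nonzero elements and the value group.

  inverse-unique : ∀ {x y z} → x *ᴷ y ≈ 1ᴷ → x *ᴷ z ≈ 1ᴷ → y ≈ z
  inverse-unique {x} {y} {z} xy≈1 xz≈1 =
    trans (sym (*-identityʳ y)) (trans (*-congˡ (sym xz≈1))
      (trans (x∙yz≈y∙xz y x z) (trans (sym (*-assoc x y z)) (trans (*-congʳ xy≈1) (*-identityˡ z)))))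

  v1≈ε : v 1ᴷ ≈⁺ [ Γ.ε ]
  v1≈ε with v 1ᴷ | ≈⁺-trans (v-cong (sym (*-identityʳ 1ᴷ))) (v-* 1ᴷ 1ᴷ) | ≉0⇒≺0 (0≉1 ∘ sym)
  ... | [ e ] | AddSupEq.[ e≈ee ] | _   = AddSupEq.[ GroupProperties.identityʳ-unique Γ-group e e (ΓO.Eq.sym e≈ee) ]
  ... | ⊤⁺    | _                 | 1≺0 = contradiction (≤⁺-reflexive v0≈∞) 1≺0

  ∼⇒≈⁺ : ∀ {x y} → x ∼ y → v x ≈⁺ v y
  ∼⇒≈⁺ (x≼y , y≼x) = AddSup.≤⁺-antisym Γ._≤_ ΓO.antisym x≼y y≼x

  ≈⁺⇒∼ : ∀ {x y} → v x ≈⁺ v y → x ∼ y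
  ≈⁺⇒∼ vx≈vy = ≤⁺-reflexive vx≈vy , ≤⁺-reflexive (≈⁺-sym vx≈vy)

  v≈⇒≉0 : ∀ {x γ} → v x ≈⁺ [ γ ] → ¬ x ≈ 0ᴷ
  v≈⇒≉0 vx≈γ x≈0 with ≈⁺-trans (≈⁺-sym vx≈γ) (≈⁺-trans (v-cong x≈0) v0≈∞)
  ... | ()

  valued : ∀ x → ¬ x ≈ 0ᴷ → ∃ λ γ → v x ≈⁺ [ γ ]
  valued x x≉0 with v x | to (v≈∞⇔≈0 x)
  ... | [ γ ] | _      = γ , ≈⁺-refl
  ... | ⊤⁺    | vx≈∞⇒ = contradiction (vx≈∞⇒ ≈⁺-refl) x≉0

  value : ∀ x → ¬ x ≈ 0ᴷ → Γ.Carrier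
  value x x≉0 = proj₁ (valued x x≉0)

  v≈value : ∀ {x} (x≉0 : ¬ x ≈ 0ᴷ) → v x ≈⁺ [ value x x≉0 ]
  v≈value {x} x≉0 = proj₂ (valued x x≉0)

  value-cong : ∀ {x y} {x≉0 : ¬ x ≈ 0ᴷ} {y≉0 : ¬ y ≈ 0ᴷ} → x ∼ y → value x x≉0 Γ.≈ value y y≉0
  value-cong {x≉0 = x≉0} {y≉0} x∼y = AddSupEq.[≈]-injective Γ._≈_
    (≈⁺-trans (≈⁺-sym (v≈value x≉0)) (≈⁺-trans (∼⇒≈⁺ x∼y) (v≈value y≉0)))

  lift : Γ.Carrier → Carrier
  lift γ = proj₁ (v-surjective γ)

  v-lift : ∀ γ → v (lift γ) ≈⁺ [ γ ]
  v-lift γ = proj₂ (v-surjective γ)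

  lift-cong : ∀ {γ δ} → γ Γ.≈ δ → lift γ ∼ lift δ
  lift-cong {γ} {δ} γ≈δ =
    ≈⁺⇒∼ (≈⁺-trans (v-lift γ) (≈⁺-trans AddSupEq.[ γ≈δ ] (≈⁺-sym (v-lift δ))))

  ∃≺1 : ∃ λ u → u ≺ 1ᴷ
  ∃≺1 with nontrivial
  ... | γ , γ≉ε with em {lift γ ≺ 1ᴷ} | em {1ᴷ ≺ lift γ}
  ...   | yes u≺1 | _       = lift γ , u≺1
  ...   | no u⊀1  | no u⊁1  = contradiction
    (AddSupEq.[≈]-injective Γ._≈_ (≈⁺-trans (≈⁺-sym (v-lift γ)) (≈⁺-trans (∼⇒≈⁺ (dne u⊁1 , dne u⊀1)) v1≈ε))) γ≉ε
  ...   | no _    | yes 1≺u with inverse (lift γ) (v≈⇒≉0 (v-lift γ))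
  ...     | u⁻¹ , uu⁻¹≈1 = u⁻¹ , λ 1≼u⁻¹ → 1≺u
    (≼-trans (≼-reflexive (sym (*-identityʳ _))) (≼-trans (*-mono-≼ ≼-refl 1≼u⁻¹) (≼-reflexive uu⁻¹≈1)))

  no-least : ∀ {x} → ¬ x ≈ 0ᴷ → ∃ λ y → y ≺ x
  no-least {x} x≉0 with ∃≺1
  ... | u , u≺1 = u *ᴷ x , ≺-≼-trans (*-monoˡ-≺ x x≉0 u≺1) (≼-reflexive (*-identityˡ x))

  x-0≈x : ∀ x → x -ᴷ 0ᴷ ≈ x
  x-0≈x x = trans (+-congˡ -0#≈0#) (+-identityʳ x)

  -- Roots of polynomials: dense value group and infinite residue field.

  module _ (c : Carrier) (c≉0 : ¬ c ≈ 0ᴷ) where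

    power : ℕ → Carrier
    power zero    = 1ᴷ
    power (suc n) = c *ᴷ power n

    power-≉0 : ∀ n → ¬ power n ≈ 0ᴷ
    power-≉0 zero    1≈0 = 0≉1 (sym 1≈0)
    power-≉0 (suc n) = *-≉0 c≉0 (power-≉0 n)

    product-≼ : ∀ {ts} → All (_≼ c) ts → product ts ≼ power (List.length ts)
    product-≼ []             = ≼-refl
    product-≼ (t≼c ∷ ts≼c) = *-mono-≼ t≼c (product-≼ ts≼c)

    product-≽ : ∀ {ts} → All (c ≼_) ts → power (List.length ts) ≼ product ts
    product-≽ []             = ≼-refl
    product-≽ (c≼t ∷ c≼ts) = *-mono-≼ c≼t (product-≽ c≼ts)

    -- The bound on the product leaves no surplus over the lower bounds of the factors. Replacing
    -- the tail by its lower bound and cancelling bounds the head; replacing the head and cancelling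
    -- bounds the tail.
    factors-≼ : ∀ {ts} → All (c ≼_) ts → product ts ≼ power (List.length ts) → All (_≼ c) ts
    factors-≼ []                           _  = []
    factors-≼ {t ∷ ts} (c≼t ∷ c≼ts) tp≼cq =
      *-cancelʳ-≼ _ (power-≉0 (List.length ts))
        (≼-trans (*-mono-≼ ≼-refl (product-≽ c≼ts)) tp≼cq) ∷
      factors-≼ c≼ts (*-cancelˡ-≼ c c≉0 (≼-trans (*-monoˡ-≼ _ c≼t) tp≼cq))

  module AlgebraicClosure (closed : AlgebraicallyClosed) where

    product-solvable : ∀ a as u → ∃ λ x → (x -ᴷ a) *ᴷ product (linearFactors x as) ≈ u
    -- The polynomial is -u + (X - a)(X - a₁) ⋯ (X - aₙ), which is monic of degree at least one;
    -- `mulLinear` takes the constant -u as its second argument.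
    product-solvable a as u with closed (mulLinear a (-ᴷ u) (monic as)) last≉0
      where
      last≉0 : ¬ Vec.last (mulLinear a (-ᴷ u) (monic as)) ≈ 0ᴷ
      last≉0 rewrite last-mulLinear-monic a (-ᴷ u) as = 0≉1 ∘ sym
    ... | x , root = x , trans (*-congˡ (sym (evalPoly-monic as x)))
      (trans (sym (+-identityˡ _)) (trans (+-congʳ (sym (-‿inverseʳ u))) (trans (+-assoc u (-ᴷ u) _)
        (trans (+-congˡ (trans (sym (evalPoly-mulLinear a (-ᴷ u) (monic as) x)) root)) (+-identityʳ u)))))

    square-root : ∀ u → ∃ λ x → x *ᴷ x ≈ u
    square-root u with product-solvable 0ᴷ (0ᴷ ∷ []) u
    ... | x , eq = x , trans (*-cong (sym (x-0≈x x)) (trans (sym (x-0≈x x)) (sym (*-identityʳ _)))) eq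

    -- A square root of xy has its value halfway between v(x) and v(y).
    ≺-dense : ∀ {x y} → x ≺ y → ¬ y ≈ 0ᴷ → ∃ λ z → x ≺ z × z ≺ y
    ≺-dense {x} {y} x≺y y≉0 with square-root (x *ᴷ y)
    ... | z , zz≈xy =
      z , (λ z≼x → *-monoˡ-≺ x x≉0 x≺y
             (≼-trans (≼-reflexive (*-comm y x)) (≼-trans (≼-reflexive (sym zz≈xy)) (*-mono-≼ z≼x z≼x))))
        , (λ y≼z → *-monoˡ-≺ y y≉0 x≺y
             (≼-trans (*-mono-≼ y≼z y≼z) (≼-reflexive zz≈xy)))
      where
      x≉0 : ¬ x ≈ 0ᴷ
      x≉0 = ≺⇒≉0 x≺y

    module _ {c : Carrier} (c≉0 : ¬ c ≈ 0ᴷ) where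

      -- A root of X (X - a₁) ⋯ (X - aₙ) = cⁿ⁺¹ lies in the sphere of c and in
      -- none of the residue classes of the aᵢ.
      sphere-avoids-integral : ∀ as → All (c ≼_) as → ∃ λ x → x ∼ c × All (λ a → x -ᴷ a ≼ c) as
      sphere-avoids-integral as c≼as with product-solvable 0ᴷ as (power c c≉0 (suc (List.length as)))
      ... | x , eq = x , (x≼c , c≼x) , AllProperties.map⁻ factors≼
        where
        length-eq : List.length (linearFactors x as) ≡ List.length as
        length-eq = length-map (λ a → x -ᴷ a) as
        xp≈cq : x *ᴷ product (linearFactors x as) ≈ power c c≉0 (suc (List.length (linearFactors x as)))
        xp≈cq rewrite length-eq = trans (*-congʳ (sym (x-0≈x x))) eq
        c≼x : c ≼ x
        -- If v(x) < v(c), every x - a also has value v(x), and the left side of the equation has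
        -- value below that of cⁿ⁺¹.
        c≼x = dne λ x≺c →
          *-monoˡ-≺ _ (power-≉0 c c≉0 (List.length (linearFactors x as))) x≺c
            (≼-trans (≼-reflexive (sym xp≈cq)) (*-mono-≼ ≼-refl (product-≼ c c≉0
              (AllProperties.map⁺ (All.map (λ c≼a → ≼-trans (proj₁ (≺⇒x-y∼x (≺-≼-trans x≺c c≼a))) (≺⇒≼ x≺c)) c≼as)))))
        all-≼ : All (_≼ c) (x ∷ linearFactors x as)
        -- All n + 1 factors now have value at least v(c) while their product is cⁿ⁺¹, so each has
        -- value exactly v(c).
        all-≼ = factors-≼ c c≉0 (c≼x ∷ AllProperties.map⁺ (All.map (-‿mono-≼ c≼x) c≼as)) (≼-reflexive xp≈cq)
        x≼c : x ≼ c
        x≼c = All.head all-≼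
        factors≼ : All (_≼ c) (linearFactors x as)
        factors≼ = All.tail all-≼

      integral-part : ∀ as → ∃ λ bs → All (c ≼_) bs ×
        (∀ {x} → x ∼ c → All (λ b → x -ᴷ b ≼ c) bs → All (λ a → x -ᴷ a ≼ c) as)
      integral-part [] = [] , [] , λ _ _ → []
      integral-part (a ∷ as) with integral-part as | em {c ≼ a}
      ... | bs , c≼bs , f | yes c≼a = a ∷ bs , c≼a ∷ c≼bs , λ { x∼c (p ∷ ps) → p ∷ f x∼c ps }
      ... | bs , c≼bs , f | no a≺c = bs , c≼bs , λ x∼c ps →
        ≼-trans (proj₁ (≺⇒x-y∼y (≺-≼-trans a≺c (proj₂ x∼c)))) (≺⇒≼ a≺c) ∷ f x∼c ps

      -- This expresses that the residue field is infinite, and makes the members of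
      -- `sphereFilter c` nonempty.
      sphere-avoids : ∀ as → ∃ λ x → x ∼ c × All (λ a → x -ᴷ a ≼ c) as
      sphere-avoids as with integral-part as
      ... | bs , c≼bs , f with sphere-avoids-integral bs c≼bs
      ... | x , x∼c , ps = x , x∼c , f x∼c ps

  -- Filters that decide Boolean combinations of balls.

  -- Members are indexed by a type in `Set ℓ` rather than collected in a predicate on sets. This
  -- keeps `Eventually S` at level ℓ, where excluded middle is available and where it can define
  -- subsets of the field again.
  record FilterBase : Set (lsuc ℓ) where
    field
      Index    : Set ℓ
      Member   : Index → Pred Carrier ℓ
      directed : ∀ i j → ∃ λ k → Member k ⊆ Member i ∩ Member j

  module _ (F : FilterBase) where
    open FilterBase F

    Eventually Decides : Pred (Pred Carrier ℓ) ℓ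
    Eventually S = ∃ λ i → Member i ⊆ S
    Decides S = Eventually S ⊎ Eventually (∁ S)

    eventually-∩ : ∀ {S T} → Eventually S → Eventually T → Eventually (S ∩ T)
    eventually-∩ (i , f) (j , g) with directed i j
    ... | k , h = k , λ x∈k → f (proj₁ (h x∈k)) , g (proj₂ (h x∈k))

    eventually-mono : ∀ {S T} → S ⊆ T → Eventually S → Eventually T
    eventually-mono S⊆T (i , f) = i , λ x∈i → S⊆T (f x∈i)

    decides-resp-≐ : ∀ {S T} → S ≐ T → Decides S → Decides T
    decides-resp-≐ (S⊆T , T⊆S) (inj₁ e) = inj₁ (eventually-mono S⊆T e)
    decides-resp-≐ (S⊆T , T⊆S) (inj₂ e) = inj₂ (eventually-mono (λ ∉S x∈T → ∉S (T⊆S x∈T)) e)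

    -- Radii are written as values of field elements d; taking d = 0 gives the closed balls of
    -- radius +∞, that is, the points.
    DecidesBalls : Set ℓ
    DecidesBalls = ∀ d a → Decides (λ x → d ≼ x -ᴷ a) × Decides (λ x → d ≺ x -ᴷ a)

    module _ (decides : DecidesBalls) where

      decides-ball : ∀ {S} → IsBall S → Decides S
      decides-ball (closed a [ γ ]) with v-surjective γ
      ... | d , vd≈γ = decides-resp-≐
        (≤⁺-trans (≤⁺-reflexive (≈⁺-sym vd≈γ)) , ≤⁺-trans (≤⁺-reflexive vd≈γ))
        (proj₁ (decides d a))
      decides-ball (closed a ⊤⁺) = decides-resp-≐
        (≤⁺-trans (≤⁺-reflexive (≈⁺-sym v0≈∞)) , ≤⁺-trans (≤⁺-reflexive v0≈∞))
        (proj₁ (decides 0ᴷ a))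
      -- The whole field contains every member; the decision about some ball merely supplies an
      -- index.
      decides-ball (open′ a ⊥₋) with proj₁ (decides 0ᴷ 0ᴷ)
      ... | inj₁ (i , _) = inj₁ (i , _)
      ... | inj₂ (i , _) = inj₁ (i , _)
      decides-ball (open′ a Inf.[ γ ]) with v-surjective γ
      ... | d , vd≈γ = decides-resp-≐
        ( (λ d≺y → ≰⁺⇒<⁺ (λ y≤γ → d≺y (≤⁺-trans y≤γ (≤⁺-reflexive (≈⁺-sym vd≈γ)))))
        , (λ γ<y y≼d → <⁺⇒≰⁺ γ<y (≤⁺-trans y≼d (≤⁺-reflexive vd≈γ))) )
        (proj₂ (decides d a))

      -- The sets decided by a filter form a Boolean algebra.
      decides-combination : ∀ {S} → BooleanCombination IsBall S → Decides S
      decides-combination (gen ball) = decides-ball ball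
      decides-combination (comp s) with decides-combination s
      ... | inj₁ e = inj₂ (eventually-mono (λ x∈S x∉S → x∉S x∈S) e)
      ... | inj₂ e = inj₁ e
      decides-combination (cap s t) with decides-combination s | decides-combination t
      ... | inj₁ e | inj₁ e′ = inj₁ (eventually-∩ e e′)
      ... | inj₂ e | _       = inj₂ (eventually-mono (_∘ proj₁) e)
      ... | _      | inj₂ e′ = inj₂ (eventually-mono (_∘ proj₂) e′)
      decides-combination (cup s t) with decides-combination s | decides-combination t
      ... | inj₁ e | _       = inj₁ (eventually-mono inj₁ e)
      ... | _      | inj₁ e′ = inj₁ (eventually-mono inj₂ e′)
      ... | inj₂ e | inj₂ e′ = inj₂ (eventually-mono
        (λ { (∉S , ∉T) (inj₁ x∈S) → ∉S x∈S ; (∉S , ∉T) (inj₂ x∈T) → ∉T x∈T }) (eventually-∩ e e′))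
      decides-combination (ext S≐T s) = decides-resp-≐ S≐T (decides-combination s)

  -- v(x) tends to a cut of the value group that is not realised by any value.
  IsCut : FilterBase → Set ℓ
  IsCut F = ∀ r → Eventually F (_≺ r) ⊎ Eventually F (r ≺_)

  decidesUpSet : ∀ F → IsCut F → ∀ d → Decides F (d ≼_) × Decides F (d ≺_)
  decidesUpSet F cut d with cut d
  ... | inj₁ e = inj₂ e , inj₂ (eventually-mono F (λ x≺d d≺x → x≺d (≺⇒≼ d≺x)) e)
  ... | inj₂ e = inj₁ (eventually-mono F ≺⇒≼ e) , inj₁ e

  -- At a cut below v(a), x - a has the value of x, so a ball around a becomes a condition on v(x)
  -- alone. At a cut above v(a), x - a has the value of a, so membership does not depend on x.
  cut-decidesBalls : ∀ F → IsCut F → DecidesBalls F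
  cut-decidesBalls F cut d a with cut a
  cut-decidesBalls F cut d a | inj₁ e with decidesUpSet F cut d
  ... | D≼ , D≺ =
    transfer (λ x∼y d≼x → ≼-trans d≼x (proj₁ x∼y)) D≼ ,
    transfer (λ x∼y d≺x → ≺-≼-trans d≺x (proj₁ x∼y)) D≺
    where
    transfer : ∀ {P : Pred Carrier ℓ} → (∀ {x y} → x ∼ y → P x → P y) →
               Decides F P → Decides F (λ x → P (x -ᴷ a))
    transfer resp (inj₁ p) = inj₁ (eventually-mono F
      (λ (x≺a , Px) → resp (∼-sym (≺⇒x-y∼x x≺a)) Px) (eventually-∩ F e p))
    transfer resp (inj₂ p) = inj₂ (eventually-mono F
      (λ (x≺a , ¬Px) → ¬Px ∘ resp (≺⇒x-y∼x x≺a)) (eventually-∩ F e p))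
  cut-decidesBalls F cut d a | inj₂ e =
    constant (λ x∼y d≼x → ≼-trans d≼x (proj₁ x∼y)) , constant (λ x∼y d≺x → ≺-≼-trans d≺x (proj₁ x∼y))
    where
    constant : ∀ {P : Pred Carrier ℓ} → (∀ {x y} → x ∼ y → P x → P y) →
               Decides F (λ x → P (x -ᴷ a))
    constant {P} resp with em {P a}
    ... | yes Pa = inj₁ (eventually-mono F (λ a≺x → resp (∼-sym (≺⇒x-y∼y a≺x)) Pa) e)
    ... | no ¬Pa = inj₂ (eventually-mono F (λ a≺x → ¬Pa ∘ resp (≺⇒x-y∼y a≺x)) e)

  -- x -ᴷ a ≼ c says that x lies outside the residue class {x : v(x - a) > v(c)}.
  sphereFilter : Carrier → FilterBase
  sphereFilter c = record
    { Index    = List Carrier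
    ; Member   = λ as x → x ∼ c × All (λ a → x -ᴷ a ≼ c) as
    ; directed = λ as bs → as List.++ bs ,
        λ (x∼c , ps) → (x∼c , AllProperties.++⁻ˡ as ps) , (x∼c , AllProperties.++⁻ʳ as ps)
    }

  -- Two points of the sphere differ by an element of value at least v(c). Hence a ball that meets
  -- the sphere in a point x₀ either contains the sphere or lies in the residue class of x₀, which
  -- the filter can discard.
  sphere-decidesBalls : ∀ c → DecidesBalls (sphereFilter c)
  sphere-decidesBalls c d a = closedCase , openCase
    where
    F : FilterBase
    F = sphereFilter c
    x-x₀≽c : ∀ {x x₀} → x ∼ c → x₀ ∼ c → c ≼ x -ᴷ x₀
    x-x₀≽c x∼c x₀∼c = -‿mono-≼ (proj₂ x∼c) (proj₂ x₀∼c)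
    closedCase : Decides F (λ x → d ≼ x -ᴷ a)
    closedCase with em {∃ λ x₀ → x₀ ∼ c × d ≼ x₀ -ᴷ a} | em {d ≼ c}
    ... | no none              | _       = inj₂ ([] , λ (x∼c , _) p → none (_ , x∼c , p))
    ... | yes (x₀ , x₀∼c , p₀) | yes d≼c =
      inj₁ ([] , λ (x∼c , _) → ultrametric-≼ (≼-trans d≼c (x-x₀≽c x∼c x₀∼c)) p₀)
    ... | yes (x₀ , x₀∼c , p₀) | no c≺d  =
      inj₂ (x₀ ∷ [] , λ { (x∼c , q ∷ []) p →
        c≺d (≼-trans (ultrametric-≼ p (≼-trans p₀ (proj₁ (x-y∼y-x x₀ a)))) q) })
    openCase : Decides F (λ x → d ≺ x -ᴷ a)
    openCase with em {∃ λ x₀ → x₀ ∼ c × d ≺ x₀ -ᴷ a} | em {c ≼ d}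
    ... | no none              | _       = inj₂ ([] , λ (x∼c , _) p → none (_ , x∼c , p))
    ... | yes (x₀ , x₀∼c , p₀) | no d≺c  =
      inj₁ ([] , λ (x∼c , _) → ultrametric-≺ (≺-≼-trans d≺c (x-x₀≽c x∼c x₀∼c)) p₀)
    ... | yes (x₀ , x₀∼c , p₀) | yes c≼d =
      inj₂ (x₀ ∷ [] , λ { (x∼c , q ∷ []) p →
        ultrametric-≺ p (≺-≼-trans p₀ (proj₁ (x-y∼y-x x₀ a))) (≼-trans q c≼d) })

  -- Definable predicates over fixed parameters.

  module Definability {m : ℕ} (ps : Vec Carrier m) where

    private
      variable
        k n : ℕ

    mutual
      renameTerm : (Fin k → Fin n) → Term (𝓛div ⊕ L) k → Term (𝓛div ⊕ L) n
      renameTerm r (var i)    = var (r i)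
      renameTerm r (app f ts) = app f (renameTerms r ts)

      renameTerms : ∀ {l} → (Fin k → Fin n) → Vec (Term (𝓛div ⊕ L) k) l → Vec (Term (𝓛div ⊕ L) n) l
      renameTerms r []       = []
      renameTerms r (t ∷ ts) = renameTerm r t ∷ renameTerms r ts

    renameFormula : (Fin k → Fin n) → Formula (𝓛div ⊕ L) k → Formula (𝓛div ⊕ L) n
    renameFormula r (equal s t) = equal (renameTerm r s) (renameTerm r t)
    renameFormula r (atom R ts) = atom R (renameTerms r ts)
    renameFormula r (not φ)     = not (renameFormula r φ)
    renameFormula r (conj φ ψ)  = conj (renameFormula r φ) (renameFormula r ψ)
    renameFormula r (exists φ)  = exists (renameFormula (Fin.lift 1 r) φ)

    record Renames (r : Fin k → Fin n) (ρ : Vec Carrier k) (σ : Vec Carrier n) : Set ℓ where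
      constructor renames
      field
        lookup-rename : ∀ i → Vec.lookup σ (r i) ≡ Vec.lookup ρ i

    open Renames

    mutual
      eval-rename : ∀ {r : Fin k → Fin n} {ρ σ} → Renames r ρ σ →
                    ∀ t → eval K σ (renameTerm r t) ≡ eval K ρ t
      eval-rename h (var i)    = lookup-rename h i
      eval-rename h (app f ts) = ≡.cong (fun f) (evals-rename h ts)

      evals-rename : ∀ {l} {r : Fin k → Fin n} {ρ σ} → Renames r ρ σ →
                     ∀ (ts : Vec _ l) → evals K σ (renameTerms r ts) ≡ evals K ρ ts
      evals-rename h []       = ≡.refl
      evals-rename h (t ∷ ts) = ≡.cong₂ _∷_ (eval-rename h t) (evals-rename h ts)

    Sat-rename : ∀ {r : Fin k → Fin n} {ρ σ} → Renames r ρ σ →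
                 ∀ φ → Sat K (renameFormula r φ) σ ⇔ Sat K φ ρ
    Sat-rename h (equal s t) rewrite eval-rename h s | eval-rename h t = ⇔-refl
    Sat-rename h (atom R ts) rewrite evals-rename h ts = ⇔-refl
    Sat-rename h (not φ)     = mk⇔ (_∘ from (Sat-rename h φ)) (_∘ to (Sat-rename h φ))
    Sat-rename h (conj φ ψ)  = mk⇔
      (Product.map (to (Sat-rename h φ)) (to (Sat-rename h ψ)))
      (Product.map (from (Sat-rename h φ)) (from (Sat-rename h ψ)))
    Sat-rename {r = r} {ρ} {σ} h (exists φ)  = mk⇔
      (Product.map₂ (λ {a} → to (Sat-rename (lift-renames a) φ)))
      (Product.map₂ (λ {a} → from (Sat-rename (lift-renames a) φ)))
      where
      lift-renames : ∀ a → Renames (Fin.lift 1 r) (a ∷ ρ) (a ∷ σ)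
      lift-renames a = renames λ { zero → ≡.refl ; (suc i) → lookup-rename h i }

    record IsTerm (t : Vec Carrier n → Carrier) : Set ℓ where
      field
        term      : Term (𝓛div ⊕ L) (n + m)
        eval-term : ∀ ρ → eval K (ρ Vec.++ ps) term ≡ t ρ

    -- The parameters come after the n free variables, so a quantifier extends the context at the
    -- front and leaves them in place. The combinators below build the formula alongside the
    -- predicate it defines.
    record IsDefinable (P : Pred (Vec Carrier n) ℓ) : Set ℓ where
      field
        formula : Formula (𝓛div ⊕ L) (n + m)
        defines : ∀ ρ → P ρ ⇔ Sat K formula (ρ Vec.++ ps)

    open IsTerm
    open IsDefinable

    infixl 6 _-ᵗ_ _+ᵗ_
    infixl 7 _*ᵗ_
    infix  4 _≈ᵈ_ _≼ᵈ_ _≺ᵈ_ _∼ᵈ_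
    infixr 3 _×ᵈ_
    infixr 2 _⊎ᵈ_ _→ᵈ_

    varᵗ : (i : Fin n) → IsTerm (λ ρ → Vec.lookup ρ i)
    varᵗ i .term        = var (i ↑ˡ m)
    varᵗ i .eval-term ρ = lookup-++ˡ ρ ps i

    0ᵗ : IsTerm {n} (λ _ → 0ᴷ)
    0ᵗ .term        = app (inj₁ zero#) []
    0ᵗ .eval-term ρ = ≡.refl

    1ᵗ : IsTerm {n} (λ _ → 1ᴷ)
    1ᵗ .term        = app (inj₁ one#) []
    1ᵗ .eval-term ρ = ≡.refl

    _+ᵗ_ : ∀ {s t : Vec Carrier n → Carrier} → IsTerm s → IsTerm t → IsTerm (λ ρ → s ρ +ᴷ t ρ)
    (s +ᵗ t) .term        = app (inj₁ add#) (s .term ∷ t .term ∷ [])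
    (s +ᵗ t) .eval-term ρ = ≡.cong₂ _+ᴷ_ (s .eval-term ρ) (t .eval-term ρ)

    _*ᵗ_ : ∀ {s t : Vec Carrier n → Carrier} → IsTerm s → IsTerm t → IsTerm (λ ρ → s ρ *ᴷ t ρ)
    (s *ᵗ t) .term        = app (inj₁ mul#) (s .term ∷ t .term ∷ [])
    (s *ᵗ t) .eval-term ρ = ≡.cong₂ _*ᴷ_ (s .eval-term ρ) (t .eval-term ρ)

    _-ᵗ_ : ∀ {s t : Vec Carrier n → Carrier} → IsTerm s → IsTerm t → IsTerm (λ ρ → s ρ -ᴷ t ρ)
    (s -ᵗ t) .term        = app (inj₁ add#) (s .term ∷ app (inj₁ neg#) (t .term ∷ []) ∷ [])
    (s -ᵗ t) .eval-term ρ = ≡.cong₂ _-ᴷ_ (s .eval-term ρ) (t .eval-term ρ)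

    _≈ᵈ_ : ∀ {s t : Vec Carrier n → Carrier} → IsTerm s → IsTerm t → IsDefinable (λ ρ → s ρ ≈ t ρ)
    (s ≈ᵈ t) .formula   = equal (s .term) (t .term)
    (s ≈ᵈ t) .defines ρ rewrite s .eval-term ρ | t .eval-term ρ = ⇔-refl

    _≼ᵈ_ : ∀ {s t : Vec Carrier n → Carrier} → IsTerm s → IsTerm t → IsDefinable (λ ρ → s ρ ≼ t ρ)
    (s ≼ᵈ t) .formula   = atom (inj₁ div#) (s .term ∷ t .term ∷ [])
    (s ≼ᵈ t) .defines ρ rewrite s .eval-term ρ | t .eval-term ρ = ⇔-sym (div⇔≤ _ _)

    resp-⇔ : ∀ {P Q : Pred (Vec Carrier n) ℓ} → (∀ ρ → P ρ ⇔ Q ρ) → IsDefinable P → IsDefinable Q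
    resp-⇔ h d .formula   = d .formula
    resp-⇔ h d .defines ρ = ⇔-trans (⇔-sym (h ρ)) (d .defines ρ)

    ¬ᵈ_ : ∀ {P : Pred (Vec Carrier n) ℓ} → IsDefinable P → IsDefinable (λ ρ → ¬ P ρ)
    (¬ᵈ d) .formula   = not (d .formula)
    (¬ᵈ d) .defines ρ = mk⇔ (_∘ from (d .defines ρ)) (_∘ to (d .defines ρ))

    _×ᵈ_ : ∀ {P Q : Pred (Vec Carrier n) ℓ} → IsDefinable P → IsDefinable Q →
           IsDefinable (λ ρ → P ρ × Q ρ)
    (d ×ᵈ e) .formula   = conj (d .formula) (e .formula)
    (d ×ᵈ e) .defines ρ = mk⇔
      (Product.map (to (d .defines ρ)) (to (e .defines ρ)))
      (Product.map (from (d .defines ρ)) (from (e .defines ρ)))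

    ∃ᵈ : ∀ {P : Pred (Vec Carrier (suc n)) ℓ} → IsDefinable P → IsDefinable (λ ρ → ∃ λ x → P (x ∷ ρ))
    ∃ᵈ d .formula   = exists (d .formula)
    ∃ᵈ d .defines ρ = mk⇔
      (Product.map₂ (λ {x} → to (d .defines (x ∷ ρ))))
      (Product.map₂ (λ {x} → from (d .defines (x ∷ ρ))))

    _⊎ᵈ_ : ∀ {P Q : Pred (Vec Carrier n) ℓ} → IsDefinable P → IsDefinable Q →
           IsDefinable (λ ρ → P ρ ⊎ Q ρ)
    d ⊎ᵈ e = resp-⇔
      (λ ρ → mk⇔ (λ h → dne λ ¬p⊎q → h (¬p⊎q ∘ inj₁ , ¬p⊎q ∘ inj₂))
                 λ { (inj₁ p) (¬p , _) → ¬p p ; (inj₂ q) (_ , ¬q) → ¬q q })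
      (¬ᵈ (¬ᵈ d ×ᵈ ¬ᵈ e))

    _→ᵈ_ : ∀ {P Q : Pred (Vec Carrier n) ℓ} → IsDefinable P → IsDefinable Q →
           IsDefinable (λ ρ → P ρ → Q ρ)
    d →ᵈ e = resp-⇔
      (λ ρ → mk⇔ (λ h p → dne λ ¬q → h (p , ¬q)) λ f (p , ¬q) → ¬q (f p))
      (¬ᵈ (d ×ᵈ ¬ᵈ e))

    ∀ᵈ : ∀ {P : Pred (Vec Carrier (suc n)) ℓ} → IsDefinable P → IsDefinable (λ ρ → ∀ x → P (x ∷ ρ))
    ∀ᵈ d = resp-⇔
      (λ ρ → mk⇔ (λ h x → dne λ ¬p → h (x , ¬p)) λ f (x , ¬p) → ¬p (f x))
      (¬ᵈ ∃ᵈ (¬ᵈ d))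

    _≺ᵈ_ : ∀ {s t : Vec Carrier n → Carrier} → IsTerm s → IsTerm t → IsDefinable (λ ρ → s ρ ≺ t ρ)
    s ≺ᵈ t = ¬ᵈ (t ≼ᵈ s)

    _∼ᵈ_ : ∀ {s t : Vec Carrier n → Carrier} → IsTerm s → IsTerm t → IsDefinable (λ ρ → s ρ ∼ t ρ)
    s ∼ᵈ t = s ≼ᵈ t ×ᵈ t ≼ᵈ s

    -- Only the first k variables are renamed; `splitAt` and `join` carry the parameters over to the
    -- end of the new context.
    renameᵈ : ∀ {P : Pred (Vec Carrier k) ℓ} (r : Fin k → Fin n) {σ : Vec Carrier n → Vec Carrier k} →
              (∀ ρ i → Vec.lookup ρ (r i) ≡ Vec.lookup (σ ρ) i) →
              IsDefinable P → IsDefinable (P ∘ σ)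
    renameᵈ {k} {n} r {σ} h d .formula   = renameFormula (λ i → join n m (Sum.map₁ r (splitAt k i))) (d .formula)
    renameᵈ {k} {n} r {σ} h d .defines ρ = ⇔-trans (d .defines (σ ρ))
      (⇔-sym (Sat-rename (renames lookup-join) (d .formula)))
      where
      lookup-join : ∀ i → Vec.lookup (ρ Vec.++ ps) (join n m (Sum.map₁ r (splitAt k i))) ≡
                          Vec.lookup (σ ρ Vec.++ ps) i
      lookup-join i rewrite lookup-splitAt k (σ ρ) ps i with splitAt k i
      ... | inj₁ j = ≡.trans (lookup-++ˡ ρ ps (r j)) (h ρ j)
      ... | inj₂ j = lookup-++ʳ ρ ps j

    definable₁ : ∀ {P : Pred (Vec Carrier (suc n)) ℓ} → IsDefinable P →
                 ∀ ρ → Definable₁ K (λ x → P (x ∷ ρ))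
    definable₁ d ρ = _ , d .formula , ρ Vec.++ ps , λ { (x ∷ []) → d .defines (x ∷ ρ) }

    definable₂ : ∀ {P : Pred (Vec Carrier (suc (suc n))) ℓ} → IsDefinable P →
                 ∀ ρ → Definable K {2} (λ xs → P (xs Vec.++ ρ))
    definable₂ d ρ = _ , d .formula , ρ Vec.++ ps , λ { (x ∷ y ∷ []) → d .defines (x ∷ y ∷ ρ) }

  definable-resp : ∀ {n} {S T : Pred (Vec Carrier n) ℓ} → (∀ xs → S xs ⇔ T xs) →
                   Definable K T → Definable K S
  definable-resp h (m , φ , ps , d) = m , φ , ps , λ xs → ⇔-trans (h xs) (d xs)

  -- Generic points of spheres and endpoints of definable cuts.

  module _ (C : CMinimal K V) where
    open CMinimal C
    open AlgebraicClosure algebraicallyClosed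

    -- This is where `definable⇒balls` enters; afterwards definable sets are handled through
    -- filters.
    definable-decides : ∀ F → DecidesBalls F → ∀ {S} → Definable₁ K S → Decides F S
    definable-decides F decides d =
      decides-combination F decides (definable⇒balls K (λ _ → ⇔-refl) V _ d)

    Generic : Carrier → Pred (Pred Carrier ℓ) ℓ
    Generic c = Eventually (sphereFilter c)

    generic-decides : ∀ c {S} → Definable₁ K S → Generic c S ⊎ Generic c (∁ S)
    generic-decides c = definable-decides (sphereFilter c) (sphere-decidesBalls c)

    generic⇒nonempty : ∀ {c S} → ¬ c ≈ 0ᴷ → Generic c S → ∃ λ x → x ∼ c × S x
    generic⇒nonempty c≉0 (as , f) with sphere-avoids c≉0 as
    ... | x , x∼c , avoids = x , x∼c , f (x∼c , avoids)

    -- For a downward closed S this is a supremum of S; whether q itself belongs to S is left open.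
    IsEndpoint : Pred Carrier ℓ → Pred Carrier ℓ
    IsEndpoint S q = (∀ z → z ≺ q → S z) × (∀ z → q ≺ z → ¬ S z)

    larger : ∀ {P : Pred Carrier ℓ} (x y : ∃ P) → ∃ λ (z : ∃ P) → proj₁ x ≼ proj₁ z × proj₁ y ≼ proj₁ z
    larger x y with ≼-total (proj₁ x) (proj₁ y)
    ... | inj₁ x≼y = y , x≼y , ≼-refl
    ... | inj₂ y≼x = x , ≼-refl , y≼x

    smaller : ∀ {P : Pred Carrier ℓ} (x y : ∃ P) → ∃ λ (z : ∃ P) → proj₁ z ≼ proj₁ x × proj₁ z ≼ proj₁ y
    smaller x y with ≼-total (proj₁ x) (proj₁ y)
    ... | inj₁ x≼y = x , ≼-refl , x≼y
    ... | inj₂ y≼x = y , y≼x , ≼-refl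

    -- If S had no endpoint, the intervals (l , u) with l in S and u outside S
    -- would form a cut filter on which S is undecided.
    endpoint : ∀ {S} → (∀ {x y} → x ≼ y → S y → S x) → Definable₁ K S →
               ∃ S → ∃ (∁ S) → ∃ (IsEndpoint S)
    endpoint {S} down S-definable inside outside = dne undecided
      where
      module _ (no-endpoint : ¬ ∃ (IsEndpoint S)) where

        above : ∀ {l} → S l → ∃ λ z → l ≺ z × S z
        -- A largest value in S would be an endpoint; dually for a least value outside S in `below`.
        above {l} l∈S = dne λ none → no-endpoint
          (l , (λ z z≺l → down (≺⇒≼ z≺l) l∈S) , λ z l≺z z∈S → none (z , l≺z , z∈S))

        below : ∀ {u} → ¬ S u → ∃ λ z → z ≺ u × ¬ S z
        below {u} u∉S = dne λ none → no-endpoint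
          (u , (λ z z≺u → dne λ z∉S → none (z , z≺u , z∉S)) ,
               λ z u≺z z∈S → u∉S (down (≺⇒≼ u≺z) z∈S))

        cutFilter : FilterBase
        cutFilter = record
          { Index    = ∃ S × ∃ (∁ S)
          ; Member   = λ (l , u) x → proj₁ l ≺ x × x ≺ proj₁ u
          ; directed = λ (l , u) (l′ , u′) →
              let l″ , l≼l″ , l′≼l″ = larger l l′
                  u″ , u″≼u , u″≼u′ = smaller u u′
              in (l″ , u″) , λ (p , q) →
                (≼-≺-trans l≼l″ p , ≺-≼-trans q u″≼u) , (≼-≺-trans l′≼l″ p , ≺-≼-trans q u″≼u′)
          }

        isCut : IsCut cutFilter
        isCut r with em {S r}
        ... | yes r∈S with above r∈S
        ...   | z , r≺z , z∈S = inj₂ (((z , z∈S) , outside) , λ (z≺x , _) → ≺-trans r≺z z≺x)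
        isCut r | no r∉S with below r∉S
        ...   | z , z≺r , z∉S = inj₁ ((inside , (z , z∉S)) , λ (_ , x≺z) → ≺-trans x≺z z≺r)

        undecided : ⊥
        undecided with definable-decides cutFilter (cut-decidesBalls cutFilter isCut) S-definable
        ... | inj₁ (((l , l∈S) , (u , u∉S)) , all-in) with below u∉S
        ...   | z , z≺u , z∉S = z∉S (all-in ((λ z≼l → z∉S (down z≼l l∈S)) , z≺u))
        undecided | inj₂ (((l , l∈S) , (u , u∉S)) , all-out) with above l∈S
        ...   | z , l≺z , z∈S = all-out (l≺z , (λ u≼z → u∉S (down u≼z z∈S))) z∈S

    -- Generic lower bounds of v(g) on a sphere.

    module GenericValue {m : ℕ} (ps : Vec Carrier m) (g : Carrier → Carrier)
      (graph : ∀ {n} (i j : Fin n) → Definability.IsDefinable ps (λ ρ → g (Vec.lookup ρ i) ≈ Vec.lookup ρ j))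
      where
      open Definability ps

      ≺g-definable : ∀ {n} (i j : Fin n) → IsDefinable (λ ρ → Vec.lookup ρ i ≺ g (Vec.lookup ρ j))
      ≺g-definable i j = resp-⇔
        (λ ρ → mk⇔ (λ (y , gx≈y , z≺y) → ≺-≼-trans z≺y (≼-reflexive (sym gx≈y)))
                   (λ z≺gx → _ , refl , z≺gx))
        (∃ᵈ (graph (suc j) zero ×ᵈ varᵗ (suc i) ≺ᵈ varᵗ zero))

      -- These are the strict lower bounds of v(g) on the residue class of a, so an endpoint of
      -- `Below c a` is the infimum of v(g) on that class.
      Below : Carrier → Carrier → Pred Carrier ℓ
      Below c a z = ∀ x → c ≺ x -ᴷ a → z ≺ g x

      below-definable : ∀ {n} (c a z : Fin n) →
        IsDefinable (λ ρ → Below (Vec.lookup ρ c) (Vec.lookup ρ a) (Vec.lookup ρ z))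
      below-definable c a z =
        ∀ᵈ (varᵗ (suc c) ≺ᵈ varᵗ zero -ᵗ varᵗ (suc a) →ᵈ ≺g-definable (suc z) zero)

      below-down : ∀ {c a x y} → x ≼ y → Below c a y → Below c a x
      below-down x≼y below x c≺x-a = ≼-≺-trans x≼y (below x c≺x-a)

      below-class : ∀ {c a b z} → c ≺ a -ᴷ b → Below c b z → Below c a z
      below-class c≺a-b below x c≺x-a = below x (ultrametric-≺ c≺x-a c≺a-b)

      IsBelowEndpoint : Carrier → Pred Carrier ℓ
      IsBelowEndpoint c q = ∃ λ a → a ∼ c × IsEndpoint (Below c a) q

      belowEndpoint-definable : ∀ c → Definable₁ K (IsBelowEndpoint c)
      belowEndpoint-definable c = definable₁
        (∃ᵈ (varᵗ 0F ∼ᵈ varᵗ 2F ×ᵈ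
             ∀ᵈ (varᵗ 0F ≺ᵈ varᵗ 2F →ᵈ below-definable 3F 1F 0F) ×ᵈ
             ∀ᵈ (varᵗ 2F ≺ᵈ varᵗ 0F →ᵈ ¬ᵈ below-definable 3F 1F 0F)))
        (c ∷ [])

      -- In a dense order each class has at most one infimum. If it falls inside the current
      -- interval, only the part of the interval below it is kept.
      avoid-endpoints : ∀ c as {u w} → u ≺ w → ¬ w ≈ 0ᴷ → ∃₂ λ u′ w′ →
        u ≼ u′ × u′ ≺ w′ × w′ ≼ w × (∀ {z} → u′ ≺ z → z ≺ w′ → All (λ a → ¬ IsEndpoint (Below c a) z) as)
      avoid-endpoints c [] u≺w w≉0 = _ , _ , ≼-refl , u≺w , ≼-refl , λ _ _ → []
      avoid-endpoints c (a ∷ as) {u} {w} u≺w w≉0 with avoid-endpoints c as u≺w w≉0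
      ... | u′ , w′ , u≼u′ , u′≺w′ , w′≼w , avoids
        with em {∃ λ q → u′ ≺ q × q ≺ w′ × IsEndpoint (Below c a) q}
      ... | no none = u′ , w′ , u≼u′ , u′≺w′ , w′≼w , λ u′≺z z≺w′ →
            (λ end → none (_ , u′≺z , z≺w′ , end)) ∷ avoids u′≺z z≺w′
      ... | yes (q , u′≺q , q≺w′ , (q-below , _)) =
            u′ , q , u≼u′ , u′≺q , ≼-trans (≺⇒≼ q≺w′) w′≼w , λ u′≺z z≺q →
            (λ (_ , z-above) → let t , z≺t , t≺q = ≺-dense z≺q (≺⇒≉0 q≺w′) in
              z-above t z≺t (q-below t t≺q)) ∷
            avoids u′≺z (≺-trans z≺q q≺w′)

      GenericallyBelow : Carrier → Pred Carrier ℓ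
      GenericallyBelow c z = Generic c (λ x → z ≺ g x)

      genericallyBelow-down : ∀ {c x y} → x ≼ y → GenericallyBelow c y → GenericallyBelow c x
      genericallyBelow-down x≼y = eventually-mono (sphereFilter _) (≼-≺-trans x≼y)

      -- Members of `sphereFilter c` are unions of residue classes, so a bound valid on a member is
      -- valid on the whole class of each of its points.
      generic⇒below : ∀ {c as z} → (∀ {x} → FilterBase.Member (sphereFilter c) as x → z ≺ g x) →
                      ∀ {x} → FilterBase.Member (sphereFilter c) as x → Below c x z
      generic⇒below {c} {as} f {x} (x∼c , avoids) y c≺y-x = f
        ( ≺[x-y]⇒x∼y x∼c c≺x-y
        , All.map (λ x-a≼c → dne λ y-a⋠c → ultrametric-≺ c≺x-y y-a⋠c x-a≼c) avoids )
        where
        c≺x-y : c ≺ x -ᴷ y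
        c≺x-y = ≺-≼-trans c≺y-x (proj₁ (x-y∼y-x y x))

      -- For z generically below g, only finitely many residue classes have an
      -- endpoint below z. So the endpoints cannot fill a tail of the values
      -- generically below g, and hence they avoid such a tail.
      not-genericallyBelow : ∀ {c} → ¬ c ≈ 0ᴷ → Generic c (λ x → ¬ GenericallyBelow c (g x))
      not-genericallyBelow {c} c≉0 with em {∃ (GenericallyBelow c)}
      ... | no none = [] , λ _ gb → none (_ , gb)
      ... | yes (δ₀ , δ₀-below) with em {∃ λ δ → GenericallyBelow c δ × (∀ z → GenericallyBelow c z → z ≼ δ)}
      ...   | yes (δ , δ-below , greatest) =
        -- A greatest generic lower bound δ is strictly below v(g x) for generic x, so such a g x is
        -- not a generic lower bound.
        eventually-mono (sphereFilter c) (λ δ≺gx gb → δ≺gx (greatest _ gb)) δ-below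
      ...   | no no-greatest = [ impossible , tail-free ]′
              (definable-decides tails (cut-decidesBalls tails isCut) (belowEndpoint-definable c))
        where
        above : ∀ {δ} → GenericallyBelow c δ → ∃ λ z → δ ≺ z × GenericallyBelow c z
        above {δ} δ-below = dne λ none → no-greatest
          (δ , δ-below , λ z z-below → dne λ δ≺z → none (z , δ≺z , z-below))

        -- The filter climbs to the upper end of the generic lower bounds. Since there is no
        -- greatest one, its members are nonempty.
        tails : FilterBase
        tails = record
          { Index    = ∃ (GenericallyBelow c)
          ; Member   = λ δ x → GenericallyBelow c x × proj₁ δ ≺ x
          ; directed = λ δ ε → let ζ , δ≼ζ , ε≼ζ = larger δ ε in
              ζ , λ (gb , ζ≺x) → (gb , ≼-≺-trans δ≼ζ ζ≺x) , (gb , ≼-≺-trans ε≼ζ ζ≺x)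
          }

        isCut : IsCut tails
        isCut r with em {GenericallyBelow c r}
        ... | yes r-below = inj₂ ((r , r-below) , proj₂)
        ... | no ¬r-below = inj₁ ((δ₀ , δ₀-below) , λ (x-below , _) r≼x → ¬r-below (genericallyBelow-down r≼x x-below))

        impossible : Eventually tails (IsBelowEndpoint c) → Generic c (λ x → ¬ GenericallyBelow c (g x))
        impossible ((δ₁ , δ₁-below) , endpoints) =
          let
            -- The bound δ₃ holds outside the classes in `as`. Some q between δ₁ and δ₂ is the
            -- infimum of none of these classes, yet by assumption it is the infimum of some class;
            -- that class lies outside `as`, where δ₃ > q is a lower bound.
            δ₂ , δ₁≺δ₂ , δ₂-below        = above δ₁-below
            δ₃ , δ₂≺δ₃ , as , δ₃≺g       = above δ₂-below
            u , w , δ₁≼u , u≺w , w≼δ₂ , avoids = avoid-endpoints c as δ₁≺δ₂ (≺⇒≉0 δ₂≺δ₃)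
            q , u≺q , q≺w                = ≺-dense u≺w (≺⇒≉0 (≼-≺-trans w≼δ₂ δ₂≺δ₃))
            q≺δ₂                         = ≺-≼-trans q≺w w≼δ₂
            a , a∼c , (below , above-q)  = endpoints
              (genericallyBelow-down (≺⇒≼ q≺δ₂) δ₂-below , ≼-≺-trans δ₁≼u u≺q)
            avoids-class : All (λ b → a -ᴷ b ≼ c) as
            avoids-class = All.map (λ {b} ¬end → dne λ c≺a-b → ¬end
              ( (λ z z≺q → below-class (≺-≼-trans c≺a-b (proj₁ (x-y∼y-x a b))) (below z z≺q))
              , (λ z q≺z → above-q z q≺z ∘ below-class c≺a-b))) (avoids u≺q q≺w)
          in contradiction (generic⇒below {as = as} δ₃≺g (a∼c , avoids-class)) (above-q δ₃ (≺-trans q≺δ₂ δ₂≺δ₃))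

        tail-free : Eventually tails (∁ (IsBelowEndpoint c)) → Generic c (λ x → ¬ GenericallyBelow c (g x))
        tail-free ((δ₁ , δ₁-below) , no-endpoints) =
          -- For x outside `as`, the infimum q over its class lies between δ₂ and v(g x). If g x
          -- were generically below, q would be an endpoint in the tail above δ₁.
          let δ₂ , δ₁≺δ₂ , as , δ₂≺g = above δ₁-below in
          as , λ {x} x∈ gx-below →
            let
              gx∉ : ¬ Below c x (g x)
              gx∉ below = below x (≺-≼-trans (≉0⇒≺0 c≉0) (≼-reflexive (sym (-‿inverseʳ x)))) ≼-refl
              δ₂∈ = generic⇒below {as = as} δ₂≺g x∈
              q , below , above-q = endpoint below-down
                (definable₁ (below-definable 2F 1F 0F) (x ∷ c ∷ []))
                (δ₂ , δ₂∈) (g x , gx∉)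
              q≼gx = dne λ gx≺q → gx∉ (below (g x) gx≺q)
              δ₁≺q = ≺-≼-trans δ₁≺δ₂ (dne λ q≺δ₂ → above-q δ₂ q≺δ₂ δ₂∈)
            in no-endpoints (genericallyBelow-down q≼gx gx-below , δ₁≺q) (x , proj₁ x∈ , below , above-q)

      -- Because the sphere filter decides definable sets, failing to be a generic strict lower
      -- bound means being a generic upper bound.
      generically-≽ : ∀ {c} → ¬ c ≈ 0ᴷ → Generic c (λ x → Generic c (λ y → g y ≼ g x))
      generically-≽ {c} c≉0 = eventually-mono (sphereFilter c) generic-≼ (not-genericallyBelow c≉0)
        where
        generic-≼ : ∀ {x} → ¬ GenericallyBelow c (g x) → Generic c (λ y → g y ≼ g x)
        generic-≼ {x} ¬below with generic-decides c (definable₁ (≺g-definable 1F 0F) (g x ∷ []))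
        ... | inj₁ below = contradiction below ¬below
        ... | inj₂ e     = eventually-mono (sphereFilter c) dne e

    -- Constancy of v(g) on spheres near infinity.

    generic-resp-∼ : ∀ {c d S} → c ∼ d → Generic c S → Generic d S
    generic-resp-∼ c∼d (as , f) = as , λ (x∼d , avoids) →
      f (∼-trans x∼d (∼-sym c∼d) , All.map (λ p → ≼-trans p (proj₂ c∼d)) avoids)

    module ConstantNearInfinity {m : ℕ} (ps : Vec Carrier m) (g : Carrier → Carrier)
      (g≉0 : ∀ x → ¬ g x ≈ 0ᴷ)
      (graph : ∀ {n} (i j : Fin n) → Definability.IsDefinable ps (λ ρ → g (Vec.lookup ρ i) ≈ Vec.lookup ρ j))
      where
      open Definability ps

      g⁻¹ : Carrier → Carrier
      g⁻¹ x = proj₁ (inverse (g x) (g≉0 x))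

      g*g⁻¹≈1 : ∀ x → g x *ᴷ g⁻¹ x ≈ 1ᴷ
      g*g⁻¹≈1 x = proj₂ (inverse (g x) (g≉0 x))

      g⁻¹-graph : ∀ {n} (i j : Fin n) → IsDefinable (λ ρ → g⁻¹ (Vec.lookup ρ i) ≈ Vec.lookup ρ j)
      g⁻¹-graph i j = resp-⇔
        (λ ρ → mk⇔
          (λ (w , gx≈w , wy≈1) → inverse-unique (g*g⁻¹≈1 _) (trans (*-congʳ gx≈w) wy≈1))
          (λ g⁻¹x≈y → _ , refl , trans (*-congˡ (sym g⁻¹x≈y)) (g*g⁻¹≈1 _)))
        (∃ᵈ (graph (suc i) zero ×ᵈ varᵗ zero *ᵗ varᵗ (suc j) ≈ᵈ 1ᵗ))

      g⁻¹-anti-≼ : ∀ {x y} → g⁻¹ x ≼ g⁻¹ y → g y ≼ g x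
      g⁻¹-anti-≼ {x} {y} g⁻¹x≼g⁻¹y = *-cancelʳ-≼ (g⁻¹ y) (*-inverse-≉0 (g*g⁻¹≈1 y))
        (≼-trans (≼-reflexive (trans (g*g⁻¹≈1 y) (sym (g*g⁻¹≈1 x)))) (*-mono-≼ ≼-refl g⁻¹x≼g⁻¹y))

      private
        module G   = GenericValue ps g graph
        module G⁻¹ = GenericValue ps g⁻¹ g⁻¹-graph

      -- Generic upper bounds for v(g) and for v(1/g) occur at a common point of the sphere, and
      -- inversion turns the second into a lower bound for v(g).
      generically-constant : ∀ {c} → ¬ c ≈ 0ᴷ → ∃ λ x → x ∼ c × Generic c (λ y → g y ∼ g x)
      generically-constant {c} c≉0 =
        let x , x∼c , gy≼gx , g⁻¹y≼g⁻¹x = generic⇒nonempty c≉0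
              (eventually-∩ (sphereFilter c) (G.generically-≽ c≉0) (G⁻¹.generically-≽ c≉0))
        in x , x∼c ,
        eventually-mono (sphereFilter c) (λ {y} (p , q) → p , g⁻¹-anti-≼ {y} {x} q)
          (eventually-∩ (sphereFilter c) gy≼gx g⁻¹y≼g⁻¹x)

      g∼-definable : ∀ {n} (i j : Fin n) → IsDefinable (λ ρ → g (Vec.lookup ρ i) ∼ Vec.lookup ρ j)
      g∼-definable i j = resp-⇔
        (λ ρ → mk⇔ (λ (u , gx≈u , u∼y) → ∼-trans (∼-reflexive gx≈u) u∼y) (λ gx∼y → _ , refl , gx∼y))
        (∃ᵈ (graph (suc i) zero ×ᵈ varᵗ zero ∼ᵈ varᵗ (suc j)))

      g∼g-definable : ∀ {n} (i j : Fin n) → IsDefinable (λ ρ → g (Vec.lookup ρ i) ∼ g (Vec.lookup ρ j))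
      g∼g-definable i j = resp-⇔
        (λ ρ → mk⇔ (λ (u , gy≈u , gx∼u) → ∼-trans gx∼u (∼-reflexive (sym gy≈u)))
                   (λ gx∼gy → _ , refl , gx∼gy))
        (∃ᵈ (graph (suc j) zero ×ᵈ g∼-definable (suc i) zero))

      -- A first-order rendering of "g z ∼ g x for generic z ∼ x": a union of
      -- residue classes in a sphere is cofinite iff its sumset covers the sphere.
      Typical : Pred Carrier ℓ
      Typical x = ∀ y → y ∼ x → ∃ λ z → ∃ λ z′ →
        z ∼ x × z′ ∼ x × y ≈ z +ᴷ z′ × g z ∼ g x × g z′ ∼ g x

      typical-definable : Definable₁ K Typical
      typical-definable = definable₁
        (∀ᵈ (varᵗ 0F ∼ᵈ varᵗ 1F →ᵈ ∃ᵈ (∃ᵈ (varᵗ z ∼ᵈ varᵗ x ×ᵈ varᵗ z′ ∼ᵈ varᵗ x ×ᵈ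
          varᵗ y ≈ᵈ varᵗ z +ᵗ varᵗ z′ ×ᵈ g∼g-definable z x ×ᵈ g∼g-definable z′ x)))) []
        where
        z′ z y x : Fin 4
        z′ = 0F
        z  = 1F
        y  = 2F
        x  = 3F

      -- The summands are z and y - z. Avoiding the class of y keeps y - z on the sphere; avoiding
      -- the classes of a and of y - a, for a in `as`, keeps both summands out of the exceptional
      -- classes.
      generic⇒typical : ∀ {x} → ¬ x ≈ 0ᴷ → Generic x (λ z → g z ∼ g x) → Typical x
      generic⇒typical {x} x≉0 (as , f) y y∼x =
        build (sphere-avoids x≉0 (y ∷ as List.++ List.map (λ a → y -ᴷ a) as))
        where
        build : (∃ λ z → z ∼ x × All (λ a → z -ᴷ a ≼ x) (y ∷ as List.++ List.map (λ a → y -ᴷ a) as)) →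
                ∃ λ z → ∃ λ z′ → z ∼ x × z′ ∼ x × y ≈ z +ᴷ z′ × g z ∼ g x × g z′ ∼ g x
        build (z , z∼x , z-y≼x ∷ avoids) =
          z , y -ᴷ z , z∼x , y-z∼x , sym (trans (+-comm z (y -ᴷ z)) ([x-y]+y≈x z y)) ,
          f (z∼x , AllProperties.++⁻ˡ as avoids) ,
          f (y-z∼x , All.map (λ {a} → ≼-trans (proj₁ (y-z-a∼z-[y-a] a)))
                       (AllProperties.map⁻ (AllProperties.++⁻ʳ as avoids)))
          where
          y-z∼x : y -ᴷ z ∼ x
          y-z∼x = ≼-trans (proj₁ (x-y∼y-x y z)) z-y≼x , -‿mono-≼ (proj₂ y∼x) (proj₂ z∼x)
          y-z-a∼z-[y-a] : ∀ a → (y -ᴷ z) -ᴷ a ∼ z -ᴷ (y -ᴷ a)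
          y-z-a∼z-[y-a] a = ∼-trans (∼-reflexive (xy∙z≈xz∙y y (-ᴷ z) (-ᴷ a))) (x-y∼y-x (y -ᴷ a) z)

      -- Otherwise the points z of the sphere with g z ∼ g x lie in finitely many residue classes,
      -- so their sums lie in the finitely many classes of the a + a′, and some point of the sphere
      -- avoids all of these.
      typical⇒generic : ∀ {x} → ¬ x ≈ 0ᴷ → Typical x → Generic x (λ z → g z ∼ g x)
      typical⇒generic {x} x≉0 typical =
        [ (λ generic → generic) , (λ (as , f) → ⊥-elim (contra as f)) ]′
          (generic-decides x (definable₁ (g∼g-definable 0F 1F) (x ∷ [])))
        where
        module _ (as : List Carrier)
                 (f : ∀ {z} → z ∼ x × All (λ a → z -ᴷ a ≼ x) as → ¬ (g z ∼ g x)) where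
          class : ∀ {w} → w ∼ x → g w ∼ g x → Any (λ a → x ≺ w -ᴷ a) as
          class w∼x gw∼gx = dne λ none →
            f (w∼x , All.map dne (AllProperties.¬Any⇒All¬ as none)) gw∼gx

          +-classes : ∀ {y z z′ a a′} → y ≈ z +ᴷ z′ → x ≺ z -ᴷ a → x ≺ z′ -ᴷ a′ → x ≺ y -ᴷ (a +ᴷ a′)
          +-classes {y} {z} {z′} {a} {a′} y≈z+z′ p q = ≺-≼-trans (+-mono-≺ p q) (≼-reflexive
            (trans (interchange z (-ᴷ a) z′ (-ᴷ a′)) (+-cong (sym y≈z+z′) (-‿+-comm a a′))))

          contra : ⊥
          contra =
            let y , y∼x , avoids = sphere-avoids x≉0 (List.cartesianProductWith _+ᴷ_ as as)
                z , z′ , z∼x , z′∼x , y≈z+z′ , gz∼gx , gz′∼gx = typical y y∼x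
            in AllProperties.All¬⇒¬Any {P = λ b → x ≺ y -ᴷ b} (All.map (λ p ¬p → ¬p p) avoids)
                 (AnyProperties.cartesianProductWith⁺ _+ᴷ_ (+-classes y≈z+z′)
                   (class z∼x gz∼gx) (class z′∼x gz′∼gx))

      typical-below : ∀ {γ} → ¬ γ ≈ 0ᴷ → ∃ λ x → x ≺ γ × Typical x
      typical-below γ≉0 =
        let c , c≺γ           = no-least γ≉0
            c≉0               = ≺⇒≉0 c≺γ
            x , x∼c , generic = generically-constant c≉0
        in x , ≼-≺-trans (proj₁ x∼c) c≺γ ,
           generic⇒typical (∼-resp-≉0 (∼-sym x∼c) c≉0) (generic-resp-∼ (∼-sym x∼c) generic)

      -- Infinity is approached as values decrease. The filter there decides `Typical`, and
      -- `typical-below` excludes that the complement wins.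
      typical-at-infinity : ∃ λ γ → ¬ γ ≈ 0ᴷ × (∀ {x} → x ≺ γ → Typical x)
      typical-at-infinity =
        [ (λ ((γ , γ≉0) , typical) → γ , γ≉0 , λ {x} → typical {x})
        , (λ ((γ , γ≉0) , atypical) → let x , x≺γ , typical = typical-below γ≉0 in
            contradiction typical (atypical {x} x≺γ))
        ]′ (definable-decides infinity (cut-decidesBalls infinity isCut) {Typical} typical-definable)
        where
        infinity : FilterBase
        infinity = record
          { Index    = ∃ λ γ → ¬ γ ≈ 0ᴷ
          ; Member   = λ γ x → x ≺ proj₁ γ
          ; directed = λ γ δ → let ε , ε≼γ , ε≼δ = smaller γ δ in
              ε , λ x≺ε → ≺-≼-trans x≺ε ε≼γ , ≺-≼-trans x≺ε ε≼δ
          }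
        isCut : IsCut infinity
        isCut r with em {r ≈ 0ᴷ}
        ... | no r≉0  = inj₁ ((r , r≉0) , λ x≺r → x≺r)
        ... | yes r≈0 = inj₁ ((1ᴷ , 0≉1 ∘ sym) , λ x≺1 → ≺-≼-trans x≺1
                          (≼-trans (≼0 1ᴷ) (≼-reflexive (sym r≈0))))

      -- Two generic subsets of the same sphere meet, so both values of g are compared with that at
      -- a common point z.
      typical⇒∼ : ∀ {x y} → ¬ x ≈ 0ᴷ → x ∼ y → Typical x → Typical y → g x ∼ g y
      typical⇒∼ {x} {y} x≉0 x∼y typical-x typical-y =
        let z , _ , gz∼gx , gz∼gy = generic⇒nonempty x≉0 (eventually-∩ (sphereFilter x)
              (typical⇒generic x≉0 typical-x)
              (generic-resp-∼ (∼-sym x∼y) (typical⇒generic (∼-resp-≉0 x∼y x≉0) typical-y)))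
        in ∼-trans (∼-sym gz∼gx) gz∼gy

      constant-near-infinity : ∃ λ γ → ¬ γ ≈ 0ᴷ × (∀ {x y} → x ≺ γ → x ∼ y → g x ∼ g y)
      constant-near-infinity =
        let γ , γ≉0 , typical = typical-at-infinity
        in γ , γ≉0 , λ x≺γ x∼y →
          typical⇒∼ (≺⇒≉0 x≺γ) x∼y (typical x≺γ) (typical (≼-≺-trans (proj₂ x∼y) x≺γ))

    -- The induced function on the value group.

    module Factorization {m : ℕ} (ps : Vec Carrier m) (g : Carrier → Carrier)
      (g≉0 : ∀ x → ¬ g x ≈ 0ᴷ)
      (g∼-definable : ∀ {n} (i j : Fin n) → Definability.IsDefinable ps (λ ρ → g (Vec.lookup ρ i) ∼ Vec.lookup ρ j))
      (γ₀ : Carrier) (constant-below-γ₀ : ∀ {x y} → x ≺ γ₀ → x ∼ y → g x ∼ g y)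
      where
      open Definability ps

      -- Away from infinity v(g) need not be constant on spheres. The default 1 there is nonzero and
      -- makes the induced function well defined on the whole value group.
      truncated : Carrier → Carrier
      truncated x with em {x ≺ γ₀}
      ... | yes _ = g x
      ... | no  _ = 1ᴷ

      truncated-≺ : ∀ {x} → x ≺ γ₀ → truncated x ≡ g x
      truncated-≺ {x} x≺γ₀ with em {x ≺ γ₀}
      ... | yes _    = ≡.refl
      ... | no x⊀γ₀ = contradiction x≺γ₀ x⊀γ₀

      truncated-≉0 : ∀ x → ¬ truncated x ≈ 0ᴷ
      truncated-≉0 x with em {x ≺ γ₀}
      ... | yes _ = g≉0 x
      ... | no  _ = 0≉1 ∘ sym

      truncated-resp-∼ : ∀ {x y} → x ∼ y → truncated x ∼ truncated y
      truncated-resp-∼ {x} {y} x∼y with em {x ≺ γ₀} | em {y ≺ γ₀}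
      ... | yes x≺γ₀ | yes _    = constant-below-γ₀ x≺γ₀ x∼y
      ... | yes x≺γ₀ | no y⊀γ₀  = contradiction (≼-≺-trans (proj₂ x∼y) x≺γ₀) y⊀γ₀
      ... | no x⊀γ₀  | yes y≺γ₀ = contradiction (≼-≺-trans (proj₁ x∼y) y≺γ₀) x⊀γ₀
      ... | no _     | no _     = ∼-refl

      h : Func Γ.setoid Γ.setoid
      h = record
        { to   = λ γ → value (truncated (lift γ)) (truncated-≉0 (lift γ))
        ; cong = λ γ≈δ → value-cong (truncated-resp-∼ (lift-cong γ≈δ))
        }

      v-truncated : ∀ {x γ} → v x ≈⁺ [ γ ] → v (truncated x) ≈⁺ [ Func.to h γ ]
      v-truncated {x} {γ} vx≈γ = ≈⁺-trans
        (∼⇒≈⁺ (truncated-resp-∼ (≈⁺⇒∼ (≈⁺-trans vx≈γ (≈⁺-sym (v-lift γ))))))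
        (v≈value (truncated-≉0 (lift γ)))

      -- The variable k stands for `γ₀`, which is not among the fixed parameters `ps`; `definable₂`
      -- later turns it into an additional parameter.
      truncated-graph-definable : ∀ {n} (i j k : Fin n) → IsDefinable (λ ρ →
        (Vec.lookup ρ i ≺ Vec.lookup ρ k × g (Vec.lookup ρ i) ∼ Vec.lookup ρ j) ⊎
        (¬ Vec.lookup ρ i ≺ Vec.lookup ρ k × 1ᴷ ∼ Vec.lookup ρ j))
      truncated-graph-definable i j k =
        varᵗ i ≺ᵈ varᵗ k ×ᵈ g∼-definable i j ⊎ᵈ ¬ᵈ (varᵗ i ≺ᵈ varᵗ k) ×ᵈ 1ᵗ ∼ᵈ varᵗ j

      truncated-graph : ∀ x y →
        ((x ≺ γ₀ × g x ∼ y) ⊎ (¬ x ≺ γ₀ × 1ᴷ ∼ y)) ⇔ truncated x ∼ y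
      truncated-graph x y with em {x ≺ γ₀}
      ... | yes x≺γ₀ = mk⇔ [ proj₂ , (λ (x⊀γ₀ , _) → contradiction x≺γ₀ x⊀γ₀) ]′ (λ gx∼y → inj₁ (x≺γ₀ , gx∼y))
      ... | no x⊀γ₀  = mk⇔ [ (λ (x≺γ₀ , _) → contradiction x≺γ₀ x⊀γ₀) , proj₂ ]′ (λ 1∼y → inj₂ (x⊀γ₀ , 1∼y))

      h-definable : DefinableΓFunction h
      h-definable = definable-resp (λ
        { (x ∷ y ∷ []) → mk⇔
          (λ { ((_ ∷ _ ∷ []) , (vx≈γ ∷ vy≈δ ∷ []) , hγ≈δ) →
               v≈⇒≉0 vx≈γ , v≈⇒≉0 vy≈δ ,
               from (truncated-graph x y)
                 (≈⁺⇒∼ (≈⁺-trans (v-truncated vx≈γ) (≈⁺-trans AddSupEq.[ hγ≈δ ] (≈⁺-sym vy≈δ)))) })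
          (λ (x≉0 , y≉0 , p) → (value x x≉0 ∷ value y y≉0 ∷ []) , (v≈value x≉0 ∷ v≈value y≉0 ∷ []) ,
            AddSupEq.[≈]-injective Γ._≈_ (≈⁺-trans (≈⁺-sym (v-truncated (v≈value x≉0)))
              (≈⁺-trans (∼⇒≈⁺ (to (truncated-graph x y) p)) (v≈value y≉0)))) })
        (definable₂ (¬ᵈ (varᵗ 0F ≈ᵈ 0ᵗ) ×ᵈ ¬ᵈ (varᵗ 1F ≈ᵈ 0ᵗ) ×ᵈ
                     truncated-graph-definable 0F 1F 2F) (γ₀ ∷ []))

-- Passage from a partial to a total function.

theorem3p1 : (∀ {a} → ExcludedMiddle a) →
    ∀ {ℓ} {L : Language ℓ} (K : Structure (𝓛div ⊕ L)) (V : ValuedField K) →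
    CMinimal K V →
    let open ValuedField V in
    (X : Pred Carrier ℓ) (f : Func (subsetSetoid X) unitsSetoid) →
    DefinableFunction X f →
    ContainsNeighborhoodOfInfinity X →
    Σ (Func Γ.setoid Γ.setoid) λ h →
    DefinableΓFunction h ×
    ∃ λ γ₀ → ∀ x (x∈X : X x) → x ∉ closedBall 0ᴷ [ γ₀ ] →
    ∀ γ → v x ≈⁺ [ γ ] → v (proj₁ (Func.to f (x , x∈X))) ≈⁺ [ Func.to h γ ]
theorem3p1 em {ℓ} K V C X f (m , φ , ps , defines) _ =
  h , h-definable , value γ₀ γ₀≉0 , λ x x∈X x∉B γ vx≈γ →
    let x≺γ₀ : x ≺ γ₀
        x≺γ₀ γ₀≼x = x∉B (≤⁺-trans (≤⁺-reflexive (≈⁺-sym (v≈value γ₀≉0)))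
                           (≼-trans γ₀≼x (≼-reflexive (sym (x-0≈x x)))))
    in ≈⁺-trans (v-cong (trans (sym (g≈f x∈X)) (reflexive (≡.sym (truncated-≺ x≺γ₀)))))
                (v-truncated vx≈γ)
  where
  open Valuation em K V
  open Definability ps

  Graph : Carrier → Carrier → Set ℓ
  Graph x y = Σ (X x) λ x∈X → proj₁ (Func.to f (x , x∈X)) ≈ y

  -- The extension of `f` by 1 outside `X` is total and nowhere zero, and its graph is definable
  -- because `X` is the projection of the graph of `f`.
  g : Carrier → Carrier
  g x with em {P = X x}
  ... | yes x∈X = proj₁ (Func.to f (x , x∈X))
  ... | no  _   = 1ᴷ

  g≉0 : ∀ x → ¬ g x ≈ 0ᴷ
  g≉0 x with em {P = X x}
  ... | yes x∈X = proj₂ (Func.to f (x , x∈X))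
  ... | no  _   = 0≉1 ∘ sym

  g≈f : ∀ {x} (x∈X : X x) → g x ≈ proj₁ (Func.to f (x , x∈X))
  g≈f {x} x∈X with em {P = X x}
  ... | yes _   = Func.cong f refl
  ... | no x∉X  = contradiction x∈X x∉X

  Graph-definable : ∀ {n} (i j : Fin n) → IsDefinable (λ ρ → Graph (Vec.lookup ρ i) (Vec.lookup ρ j))
  Graph-definable i j = renameᵈ {k = 2} (λ { 0F → i ; 1F → j })
    {σ = λ ρ → Vec.lookup ρ i ∷ Vec.lookup ρ j ∷ []}
    (λ { ρ 0F → ≡.refl ; ρ 1F → ≡.refl })
    (record { formula = φ ; defines = defines })

  graph : ∀ {n} (i j : Fin n) → IsDefinable (λ ρ → g (Vec.lookup ρ i) ≈ Vec.lookup ρ j)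
  graph i j = resp-⇔ (λ ρ → graph-⇔ (Vec.lookup ρ i) (Vec.lookup ρ j))
    (Graph-definable i j ⊎ᵈ ¬ᵈ ∃ᵈ (Graph-definable (suc i) zero) ×ᵈ 1ᵗ ≈ᵈ varᵗ j)
    where
    graph-⇔ : ∀ x y → (Graph x y ⊎ ¬ ∃ (Graph x) × 1ᴷ ≈ y) ⇔ g x ≈ y
    graph-⇔ x y with em {P = X x}
    ... | yes x∈X = mk⇔
      [ (λ (_ , fx≈y) → trans (Func.cong f refl) fx≈y)
      , (λ (none , _) → contradiction (_ , x∈X , refl) none) ]′
      (λ fx≈y → inj₁ (x∈X , fx≈y))
    ... | no x∉X  = mk⇔
      [ (λ (x∈X , _) → contradiction x∈X x∉X) , proj₂ ]′
      (λ 1≈y → inj₂ ((λ (_ , x∈X , _) → x∉X x∈X) , 1≈y))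

  open ConstantNearInfinity C ps g g≉0 graph using (g∼-definable; constant-near-infinity)

  γ₀ : Carrier
  γ₀ = proj₁ constant-near-infinity

  γ₀≉0 : ¬ γ₀ ≈ 0ᴷ
  γ₀≉0 = proj₁ (proj₂ constant-near-infinity)

  open Factorization C ps g g≉0 g∼-definable γ₀ (proj₂ (proj₂ constant-near-infinity))
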